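{- Let $\mathbb{F}$ be a field and $n\in\mathbb{N}$ such that $\operatorname{char}(\mathbb{F})\nmid n$. Then any algebraic branching program over $\mathbb{F}$ computing the polynomial $\sum_{i=1}^n x_i^n$ is of size at least $\Omega(n^2)$. When the edge labels of the algebraic branching program are allowed to be polynomials of degree at most $\Delta$, the lower bound on the size is $\Omega(n^2/\Delta)$.
   Context: An algebraic branching program (ABP) over $\mathbb{F}$ is a layered directed graph (the vertices are partitioned into layers and every edge goes from one layer to the next layer), whose first and last layers have exactly one vertex each, called the start vertex and the end vertex, and in which each edge is labeled by an affine linear form in $\mathbb{F}[x_1,\dots,x_n]$. The polynomial computed by the ABP is the sum of the weights of all paths from the start vertex to the end vertex, where the weight of a path is the product of the labels of all the edges on it. In the more general model with edge labels of degree at most $\Delta$, each edge may be labeled by an arbitrary polynomial in $\mathbb{F}[x_1,\dots,x_n]$ of degree at most $\Delta$. The size of an ABP is the number of vertices in it. The $\Omega(\cdot)$ notation hides an absolute positive constant.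
   Formalization: The second bound is stated for 1 ≤ Δ < n: for Δ = 0 the quantity n²/Δ is undefined, and for Δ = n a single edge labeled by the sum of the x_i^n gives a program of size 2, so the bound Ω(n²/Δ) with an absolute constant fails there. -}

module Defs where

open import Algebra.Apartness.Bundles using (HeytingField; HeytingCommutativeRing)
open import Algebra.Bundles using (CommutativeRing)
import Algebra.Definitions.RawMonoid as RawMonoidDefinitions
open import Data.Bool.Base using (if_then_else_)
open import Data.Fin.Base using (Fin; zero)
import Data.Fin.Properties as Fin
open import Data.List.Base
  using (List; []; _∷_; [_]; _++_; map; foldr; concatMap; cartesianProductWith; allFin)
open import Data.Maybe.Base using (Maybe; just; nothing)
open import Data.Nat.Base using (ℕ; zero; suc; _<_) renaming (_+_ to _ℕ+_)
open import Data.Nat.Divisibility using (_∣_)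
import Data.Nat.Properties as ℕ
open import Data.Product.Base using (Σ; ∃; _×_; _,_; proj₁)
open import Data.Vec.Base as Vec using (Vec)
import Data.Vec.Properties as Vec
open import Function.Bundles using (_⇔_)
open import Level using (Level; _⊔_)
open import Relation.Binary.PropositionalEquality.Core using (_≡_; refl)
open import Relation.Nullary.Decidable.Core using (yes; no; does)

-- With classical logic, taking x # y to be ¬ (x ≈ y) makes every field a
-- Heyting field, and every Heyting field arises in this way.
ring : ∀ {c ℓ₁ ℓ₂} → HeytingField c ℓ₁ ℓ₂ → CommutativeRing c ℓ₁
ring F = HeytingCommutativeRing.commutativeRing (HeytingField.heytingCommutativeRing F)

-- p generates the kernel of ℤ → R; in particular p = 0 means that no positive
-- multiple of 1# vanishes.
HasCharacteristic : ∀ {c ℓ} → CommutativeRing c ℓ → ℕ → Set ℓ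
HasCharacteristic R p = ∀ m → ((m · 1#) ≈ 0#) ⇔ (p ∣ m)
  where
  open CommutativeRing R using (_≈_; 0#; 1#; +-rawMonoid)
  open RawMonoidDefinitions +-rawMonoid using () renaming (_×_ to _·_)

module Polynomials {c ℓ : Level} (R : CommutativeRing c ℓ) where

  open CommutativeRing R using (Carrier; _≈_; 0#; 1#; _+_; _*_)

  -- The exponent vector of x₁^m₁ ⋯ xₙ^mₙ.
  Monomial : ℕ → Set
  Monomial n = Vec ℕ n

  -- A formal sum of terms a·m.  The same monomial may occur several times and
  -- coefficients may vanish; equality is _≋_ below, not _≡_.
  Polynomial : ℕ → Set c
  Polynomial n = List (Carrier × Monomial n)

  coeff : ∀ {n} → Polynomial n → Monomial n → Carrier
  coeff []            m = 0#
  coeff ((a , k) ∷ p) m =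
    (if does (Vec.≡-dec ℕ._≟_ k m) then a else 0#) + coeff p m

  infix 4 _≋_
  _≋_ : ∀ {n} → Polynomial n → Polynomial n → Set ℓ
  p ≋ q = ∀ m → coeff p m ≈ coeff q m

  const : ∀ {n} → Carrier → Polynomial n
  const {n} a = [ a , Vec.replicate n 0 ]

  var : ∀ {n} → Fin n → Polynomial n
  var {n} i = [ 1# , Vec.replicate n 0 Vec.[ i ]≔ 1 ]

  infixl 6 _⊕_
  _⊕_ : ∀ {n} → Polynomial n → Polynomial n → Polynomial n
  _⊕_ = _++_

  infixl 7 _⊗_
  _⊗_ : ∀ {n} → Polynomial n → Polynomial n → Polynomial n
  _⊗_ = cartesianProductWith λ (a , k) (b , m) → (a * b , Vec.zipWith _ℕ+_ k m)

  infixr 8 _↑_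
  _↑_ : ∀ {n} → Polynomial n → ℕ → Polynomial n
  p ↑ zero  = const 1#
  p ↑ suc e = p ⊗ p ↑ e

  sum : ∀ {n} → List (Polynomial n) → Polynomial n
  sum = foldr _⊕_ []

  -- Total degree; the zero polynomial satisfies this for every Δ.
  DegreeAtMost : ∀ {n} → ℕ → Polynomial n → Set ℓ
  DegreeAtMost Δ p = ∀ m → Δ < Vec.sum m → coeff p m ≈ 0#

  IsAffine : ∀ {n} → Polynomial n → Set (c ⊔ ℓ)
  IsAffine {n} p =
    Σ Carrier λ a₀ → Σ (Fin n → Carrier) λ a →
      p ≋ const a₀ ⊕ sum (map (λ i → const (a i) ⊗ var i) (allFin n))

  powerSum : (n e : ℕ) → Polynomial n
  powerSum n e = sum (map (λ i → var i ↑ e) (allFin n))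

  module _ {n : ℕ} {ℓ′ : Level} (Label : Polynomial n → Set ℓ′) where

    -- Edges from a layer of a vertices to the next layer of b vertices, each
    -- labelled by a polynomial satisfying Label; nothing means "no edge".
    Edges : ℕ → ℕ → Set (c ⊔ ℓ′)
    Edges a b = Fin a → Fin b → Maybe (∃ Label)

    -- Layered graphs whose first layer has a vertices and whose last layer has
    -- b vertices.  [] has a single layer, which is both first and last.
    infixr 5 _∷_
    data Layered : ℕ → ℕ → Set (c ⊔ ℓ′) where
      []  : ∀ {a} → Layered a a
      _∷_ : ∀ {a b d} → Edges a b → Layered b d → Layered a d

    ABP : Set (c ⊔ ℓ′)
    ABP = Layered 1 1

  module _ {n : ℕ} {ℓ′ : Level} {Label : Polynomial n → Set ℓ′} where

    vertices : ∀ {a b} → Layered Label a b → ℕ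
    vertices {a} []      = a
    vertices {a} (E ∷ G) = a ℕ+ vertices G

    data Path : ∀ {a b} → Layered Label a b → Fin a → Fin b → Set (c ⊔ ℓ′) where
      []   : ∀ {a} {u : Fin a} → Path [] u u
      step : ∀ {a b d} {E : Edges Label a b} {G : Layered Label b d} {u t} v l →
             E u v ≡ just l → Path G v t → Path (E ∷ G) u t

    weight : ∀ {a b} {G : Layered Label a b} {u t} → Path G u t → Polynomial n
    weight []             = const 1#
    weight (step v l _ π) = proj₁ l ⊗ weight π

    -- Lists every path exactly once.
    paths : ∀ {a b} (G : Layered Label a b) u t → List (Path G u t)
    paths [] u t with u Fin.≟ t
    ... | yes refl = [ [] ]
    ... | no _     = []
    paths (_∷_ {b = b} E G) u t = concatMap via (allFin b)
      where
      via : Fin b → List (Path (E ∷ G) u t)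
      via v with E u v in eq
      ... | just l  = map (step v l eq) (paths G v t)
      ... | nothing = []

    size : ABP Label → ℕ
    size = vertices

    computed : ABP Label → Polynomial n
    computed G = sum (map weight (paths G zero zero))

    Computes : ABP Label → Polynomial n → Set ℓ
    Computes G p = computed G ≋ p

{-# OPTIONS --safe #-}

-- Cut the program at every H-th layer, where H = ⌊(n−1)/Δ⌋, and at a cut layer with
-- prefixes P_v and suffixes Q_v split off the constant terms, P_v = a + P′ and
-- Q_v = b + Q′.  The terms P′b have degree at most HΔ < n, and the terms aQ_v restart the
-- program at the cut.  Hence Σ x_i^n = Σ_{j<W} P′_j Q′_j + R, where W is the number of
-- vertices of the cut layers, deg R < n, and P′_j and Q′_j vanish at the origin.
--
-- Then n ≤ 2W.  For let g_1, …, g_r be the P′_j and Q′_j.  Applying ∂/∂x_i shows that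
-- n x_i^{n−1} has degree below n−1 modulo the ideal (g), so F[x] is spanned modulo (g) by
-- the n^n monomials with exponents below n.  Iterating this d times spans F[x] modulo
-- terms of degree ≥ d by n^n d^r elements, since each g_j vanishes at the origin.  But for
-- d = n t the t^n monomials with exponents below t are independent modulo these terms,
-- and if r < n they are more than n^n (n t)^r once t is large.
--
-- The H choices for the first cut use disjoint layers, so summing n ≤ 2W over them bounds
-- H n by twice the size.

module Submission where

open import Defs
open import Algebra.Apartness.Bundles using (HeytingField)
open import Algebra.Bundles using (CommutativeMonoid; CommutativeRing)
import Algebra.Properties.CommutativeMonoid.Sum as CommutativeMonoidSum
import Algebra.Properties.CommutativeSemigroup as CommutativeSemigroupProperties
import Algebra.Properties.Group as GroupProperties
import Algebra.Properties.Ring as RingProperties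
import Algebra.Properties.Semiring.Mult as Mult
import Algebra.Properties.Semiring.Sum as SemiringSum
open import Algebra.Structures using (IsCommutativeRing)
open import Data.Bool.Base using (true; false; T; if_then_else_)
open import Data.Empty using (⊥)
open import Data.Fin.Base as Fin using (Fin; zero; suc)
import Data.Fin.Properties as Fin
open import Data.List.Base as List using
  ( List; []; _∷_; [_]; _++_; map; concatMap; filter; length; allFin; tabulate
  ; cartesianProductWith; applyUpTo)
open import Data.List.Membership.Propositional using (_∈_)
open import Data.List.Membership.Propositional.Properties using
  (∈-cartesianProductWith⁺; ∈-cartesianProductWith⁻; ∈-applyUpTo⁺; ∈-applyUpTo⁻; ∈-tabulate⁺)
import Data.List.Properties as List
open import Data.List.Relation.Unary.All as All using (All; []; _∷_)
import Data.List.Relation.Unary.All.Properties as All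
open import Data.List.Relation.Unary.Any using (here; there; index)
open import Data.List.Relation.Unary.Any.Properties using (lookup-index)
open import Data.Maybe.Base using (Maybe; just; nothing)
open import Data.Nat.Base using
  (ℕ; zero; suc; pred; _<_; _≤_; _<ᵇ_; _∸_; _^_; _/_; _%_; z≤n; s≤s; z<s; >-nonZero)
  renaming (_+_ to _ℕ+_; _*_ to _ℕ*_)
open import Data.Nat.Divisibility using (_∣_)
open import Data.Nat.DivMod using (m≡m%n+[m/n]*n; m%n<n; m≥n⇒m/n>0)
open import Data.Nat.Induction using (<-wellFounded)
import Data.Nat.Properties as ℕ
open import Data.Nat.Solver using (module +-*-Solver)
open import Data.Product.Base using (∃; ∃-syntax; Σ-syntax; _×_; _,_; proj₁; proj₂)
open import Data.Sum.Base using (_⊎_; inj₁; inj₂)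
open import Data.Unit.Base using (⊤; tt)
open import Data.Vec.Base as Vec using (Vec)
open import Data.Vec.Functional as VecF using ()
import Data.Vec.Properties as Vec
open import Function.Base using (_∘_; id)
open import Function.Bundles using (Equivalence)
open import Induction.WellFounded using (Acc; acc)
open import Level using (Level; _⊔_)
open import Relation.Binary.PropositionalEquality.Core as ≡ using (_≡_; _≢_; _≗_)
import Relation.Binary.Reasoning.Setoid as SetoidReasoning
open import Relation.Nullary.Decidable using
  (yes; no; does; dec-true; dec-false; ¬?; ¬¬-excluded-middle)
open import Relation.Nullary.Negation.Core using (¬_; contradiction)

-- Finite sums with a single nonzero term.

module SumSingle {c ℓ : Level} (M : CommutativeMonoid c ℓ) where

  open CommutativeMonoid M
  open CommutativeMonoidSum M

  sum-single : ∀ {k} (f : Fin k → Carrier) i → (∀ j → j ≢ i → f j ≈ ε) → sum f ≈ f i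
  sum-single {suc k} f i f≈ε = trans (sum-remove {i = i} f)
    (trans (∙-congˡ (trans (sum-cong-≋ λ j → f≈ε _ (Fin.punchInᵢ≢i i j)) (sum-replicate-zero k)))
           (identityʳ (f i)))

-- Polynomials as functionals on functions of the exponent vector.

module Pairing {c ℓ : Level} (R : CommutativeRing c ℓ) where

  open CommutativeRing R hiding (ring)
  open Polynomials R
  open CommutativeSemigroupProperties +-commutativeSemigroup
    using () renaming (interchange to +-interchange; x∙yz≈y∙xz to +-leftCommute)
  open CommutativeSemigroupProperties *-commutativeSemigroup
    using () renaming (x∙yz≈y∙xz to *-leftCommute)
  open SetoidReasoning setoid

  infixl 6 _+ᵐ_
  _+ᵐ_ : ∀ {n} → Monomial n → Monomial n → Monomial n
  _+ᵐ_ = Vec.zipWith _ℕ+_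

  1ᵐ : ∀ {n} → Monomial n
  1ᵐ {n} = Vec.replicate n 0

  -- Linear in both arguments. Coefficients, products and derivatives are all pairings with a
  -- suitable `φ`, so the ring laws reduce to identities of finite sums, whatever the order and
  -- repetition of terms in the lists.
  ⟨_,_⟩ : ∀ {n} → Polynomial n → (Monomial n → Carrier) → Carrier
  ⟨ []          , φ ⟩ = 0#
  ⟨ (a , k) ∷ p , φ ⟩ = a * φ k + ⟨ p , φ ⟩

  δ : ∀ {n} → Monomial n → Monomial n → Carrier
  δ m k = if does (Vec.≡-dec ℕ._≟_ k m) then 1# else 0#

  δ-refl : ∀ {n} (m : Monomial n) → δ m m ≈ 1#
  δ-refl m rewrite dec-true (Vec.≡-dec ℕ._≟_ m m) ≡.refl = refl

  δ-≢ : ∀ {n} {m k : Monomial n} → k ≢ m → δ m k ≈ 0#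
  δ-≢ {m = m} {k} k≢m rewrite dec-false (Vec.≡-dec ℕ._≟_ k m) k≢m = refl

  coeff≈pairing : ∀ {n} (p : Polynomial n) m → coeff p m ≈ ⟨ p , δ m ⟩
  coeff≈pairing []            m = refl
  coeff≈pairing ((a , k) ∷ p) m with does (Vec.≡-dec ℕ._≟_ k m)
  ... | true  = +-cong (sym (*-identityʳ a)) (coeff≈pairing p m)
  ... | false = +-cong (sym (zeroʳ a)) (coeff≈pairing p m)

  pairing-cong : ∀ {n} (p : Polynomial n) {φ ψ : Monomial n → Carrier} →
                 (∀ k → φ k ≈ ψ k) → ⟨ p , φ ⟩ ≈ ⟨ p , ψ ⟩
  pairing-cong []            φ≈ψ = refl
  pairing-cong ((a , k) ∷ p) φ≈ψ = +-cong (*-congˡ (φ≈ψ k)) (pairing-cong p φ≈ψ)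

  pairing-⊕ : ∀ {n} (p q : Polynomial n) {φ} → ⟨ p ⊕ q , φ ⟩ ≈ ⟨ p , φ ⟩ + ⟨ q , φ ⟩
  pairing-⊕ []      q = sym (+-identityˡ _)
  pairing-⊕ (t ∷ p) q = trans (+-congˡ (pairing-⊕ p q)) (sym (+-assoc _ _ _))

  pairing-0ʳ : ∀ {n} (p : Polynomial n) → ⟨ p , (λ _ → 0#) ⟩ ≈ 0#
  pairing-0ʳ []            = refl
  pairing-0ʳ ((a , k) ∷ p) = trans (+-cong (zeroʳ a) (pairing-0ʳ p)) (+-identityʳ 0#)

  pairing-+ʳ : ∀ {n} (p : Polynomial n) {φ ψ} → ⟨ p , (λ k → φ k + ψ k) ⟩ ≈ ⟨ p , φ ⟩ + ⟨ p , ψ ⟩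
  pairing-+ʳ []            = sym (+-identityʳ 0#)
  pairing-+ʳ ((a , k) ∷ p) =
    trans (+-cong (distribˡ a _ _) (pairing-+ʳ p)) (+-interchange _ _ _ _)

  pairing-*ʳ : ∀ {n} (p : Polynomial n) {φ} b → ⟨ p , (λ k → b * φ k) ⟩ ≈ b * ⟨ p , φ ⟩
  pairing-*ʳ []            b = sym (zeroʳ b)
  pairing-*ʳ ((a , k) ∷ p) b =
    trans (+-cong (*-leftCommute a b _) (pairing-*ʳ p b)) (sym (distribˡ b _ _))

  pairing-swap : ∀ {n} (p q : Polynomial n) {φ : Monomial n → Monomial n → Carrier} →
                 ⟨ p , (λ k → ⟨ q , φ k ⟩) ⟩ ≈ ⟨ q , (λ l → ⟨ p , (λ k → φ k l) ⟩) ⟩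
  pairing-swap []            q = sym (pairing-0ʳ q)
  pairing-swap ((a , k) ∷ p) q {φ} = begin
    a * ⟨ q , φ k ⟩ + ⟨ p , (λ k → ⟨ q , φ k ⟩) ⟩
      ≈⟨ +-cong (sym (pairing-*ʳ q a)) (pairing-swap p q) ⟩
    ⟨ q , (λ l → a * φ k l) ⟩ + ⟨ q , (λ l → ⟨ p , (λ k → φ k l) ⟩) ⟩
      ≈⟨ pairing-+ʳ q ⟨
    ⟨ q , (λ l → a * φ k l + ⟨ p , (λ k → φ k l) ⟩) ⟩ ∎

  private
    pairing-term : ∀ {n} a (k : Monomial n) (q : Polynomial n) {φ} →
                   ⟨ map (λ (b , m) → a * b , k +ᵐ m) q , φ ⟩ ≈ a * ⟨ q , (λ l → φ (k +ᵐ l)) ⟩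
    pairing-term a k []            = sym (zeroʳ a)
    pairing-term a k ((b , l) ∷ q) =
      trans (+-cong (*-assoc a b _) (pairing-term a k q)) (sym (distribˡ a _ _))

  pairing-⊗ : ∀ {n} (p q : Polynomial n) {φ} →
              ⟨ p ⊗ q , φ ⟩ ≈ ⟨ p , (λ k → ⟨ q , (λ l → φ (k +ᵐ l)) ⟩) ⟩
  pairing-⊗ []            q = refl
  pairing-⊗ ((a , k) ∷ p) q =
    trans (pairing-⊕ (map _ q) (p ⊗ q)) (+-cong (pairing-term a k q) (pairing-⊗ p q))

  infixr 7 _∙_
  _∙_ : ∀ {n} → Carrier → Polynomial n → Polynomial n
  b ∙ p = map (λ (a , k) → b * a , k) p

  pairing-∙ : ∀ {n} b (p : Polynomial n) {φ} → ⟨ b ∙ p , φ ⟩ ≈ b * ⟨ p , φ ⟩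
  pairing-∙ b []            = sym (zeroʳ b)
  pairing-∙ b ((a , k) ∷ p) =
    trans (+-cong (*-assoc b a _) (pairing-∙ b p)) (sym (distribˡ b _ _))

  private
    without : ∀ {n} → Monomial n → Polynomial n → Polynomial n
    without k = filter (λ (_ , l) → ¬? (Vec.≡-dec ℕ._≟_ l k))

    -- All occurrences of `k` in the list are gathered into one term, whose coefficient is then
    -- `coeff p k`.
    pairing-split : ∀ {n} k (p : Polynomial n) {φ} → ⟨ p , φ ⟩ ≈ coeff p k * φ k + ⟨ without k p , φ ⟩
    pairing-split k []            = trans (sym (zeroˡ _)) (sym (+-identityʳ _))
    pairing-split k ((a , l) ∷ p) {φ} with Vec.≡-dec ℕ._≟_ l k
    ... | yes ≡.refl = begin
      a * φ k + ⟨ p , φ ⟩                               ≈⟨ +-congˡ (pairing-split k p) ⟩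
      a * φ k + (coeff p k * φ k + ⟨ without k p , φ ⟩) ≈⟨ +-assoc _ _ _ ⟨
      a * φ k + coeff p k * φ k + ⟨ without k p , φ ⟩   ≈⟨ +-congʳ (distribʳ _ _ _) ⟨
      (a + coeff p k) * φ k + ⟨ without k p , φ ⟩       ∎
    ... | no _ = begin
      a * φ l + ⟨ p , φ ⟩                                      ≈⟨ +-congˡ (pairing-split k p) ⟩
      a * φ l + (coeff p k * φ k + ⟨ without k p , φ ⟩)        ≈⟨ +-leftCommute _ _ _ ⟩
      coeff p k * φ k + (a * φ l + ⟨ without k p , φ ⟩)        ≈⟨ +-congʳ (*-congʳ (+-identityˡ _)) ⟨
      (0# + coeff p k) * φ k + (a * φ l + ⟨ without k p , φ ⟩) ∎

    coeff-without : ∀ {n} k (p : Polynomial n) m →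
                    coeff p m ≈ coeff p k * δ m k + coeff (without k p) m
    coeff-without k p m = begin
      coeff p m                                     ≈⟨ coeff≈pairing p m ⟩
      ⟨ p , δ m ⟩                                   ≈⟨ pairing-split k p ⟩
      coeff p k * δ m k + ⟨ without k p , δ m ⟩     ≈⟨ +-congˡ (coeff≈pairing (without k p) m) ⟨
      coeff p k * δ m k + coeff (without k p) m     ∎

    coeff-without-≢ : ∀ {n} {k m} (p : Polynomial n) → k ≢ m → coeff (without k p) m ≈ coeff p m
    coeff-without-≢ {k = k} {m} p k≢m = sym (begin
      coeff p m                                 ≈⟨ coeff-without k p m ⟩
      coeff p k * δ m k + coeff (without k p) m ≈⟨ +-congʳ (trans (*-congˡ (δ-≢ k≢m)) (zeroʳ _)) ⟩
      0# + coeff (without k p) m                ≈⟨ +-identityˡ _ ⟩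
      coeff (without k p) m                     ∎)

    coeff-without-≡ : ∀ {n} k (p : Polynomial n) → coeff (without k p) k ≈ 0#
    coeff-without-≡ k p = identityʳ-unique (coeff p k) _ (sym (begin
      coeff p k                                 ≈⟨ coeff-without k p k ⟩
      coeff p k * δ k k + coeff (without k p) k ≈⟨ +-congʳ (trans (*-congˡ (δ-refl k)) (*-identityʳ _)) ⟩
      coeff p k + coeff (without k p) k         ∎))
      where open GroupProperties +-group using (identityʳ-unique)

    without-shortens : ∀ {n} a k (p : Polynomial n) → length (without k ((a , k) ∷ p)) < suc (length p)
    without-shortens a k p with Vec.≡-dec ℕ._≟_ k k
    ... | yes _  = s≤s (List.length-filter _ p)
    ... | no k≢k = contradiction ≡.refl k≢k

  -- Monomials may repeat with cancelling coefficients, so the hypothesis need not pass to the tail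
  -- of the list. All occurrences of the leading monomial are therefore removed at once, and the
  -- induction is on the length.
  pairing-zero : ∀ {n} (p : Polynomial n) {φ} → (∀ k → coeff p k * φ k ≈ 0#) → ⟨ p , φ ⟩ ≈ 0#
  pairing-zero p = go p (<-wellFounded _)
    where
    go : ∀ {n} (p : Polynomial n) {φ} → Acc _<_ (length p) → (∀ k → coeff p k * φ k ≈ 0#) → ⟨ p , φ ⟩ ≈ 0#
    go [] _ _ = refl
    go p@((a , k) ∷ p₀) {φ} (acc rs) vanishes = begin
      ⟨ p , φ ⟩                               ≈⟨ pairing-split k p ⟩
      coeff p k * φ k + ⟨ without k p , φ ⟩   ≈⟨ +-cong (vanishes k) (go (without k p) (rs (without-shortens a k p₀)) vanishes′) ⟩
      0# + 0#                                 ≈⟨ +-identityʳ 0# ⟩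
      0#                                      ∎
      where
      vanishes′ : ∀ m → coeff (without k p) m * φ m ≈ 0#
      vanishes′ m with Vec.≡-dec ℕ._≟_ k m
      ... | yes ≡.refl = trans (*-congʳ (coeff-without-≡ k p)) (zeroˡ _)
      ... | no k≢m     = trans (*-congʳ (coeff-without-≢ p k≢m)) (vanishes m)

  -- Equivalent to _≋_.  Unlike _≋_ it determines p and q, so that Agda infers
  -- them, and it visibly respects _⊗_.
  infix 4 _≈ₚ_
  record _≈ₚ_ {n} (p q : Polynomial n) : Set (c ⊔ ℓ) where
    constructor pairings
    field pairing-≈ : ∀ φ → ⟨ p , φ ⟩ ≈ ⟨ q , φ ⟩

  open _≈ₚ_ public

  ≈ₚ⇒≋ : ∀ {n} {p q : Polynomial n} → p ≈ₚ q → p ≋ q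
  ≈ₚ⇒≋ {p = p} {q} p≈q m = trans (coeff≈pairing p m) (trans (pairing-≈ p≈q (δ m)) (sym (coeff≈pairing q m)))

  -- Every coefficient of the difference of `p` and `q` vanishes, so by `pairing-zero` the
  -- difference pairs to zero with every `φ`.
  ≋⇒≈ₚ : ∀ {n} {p q : Polynomial n} → p ≋ q → p ≈ₚ q
  ≋⇒≈ₚ {p = p} {q} p≋q = pairings λ φ → x-y≈0⇒x≈y _ _ (trans (sym difference) (pairing-zero (p ⊕ (- 1# ∙ q)) (vanishes φ)))
    where
    open RingProperties (CommutativeRing.ring R) using (-1*x≈-x)
    open GroupProperties +-group using () renaming (x∙y⁻¹≈ε⇒x≈y to x-y≈0⇒x≈y)
    difference : ∀ {φ} → ⟨ p ⊕ (- 1# ∙ q) , φ ⟩ ≈ ⟨ p , φ ⟩ - ⟨ q , φ ⟩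
    difference = trans (pairing-⊕ p _) (+-congˡ (trans (pairing-∙ (- 1#) q) (-1*x≈-x _)))
    vanishes : ∀ φ k → coeff (p ⊕ (- 1# ∙ q)) k * φ k ≈ 0#
    vanishes φ k = trans (*-congʳ (begin
      coeff (p ⊕ (- 1# ∙ q)) k    ≈⟨ coeff≈pairing (p ⊕ (- 1# ∙ q)) k ⟩
      ⟨ p ⊕ (- 1# ∙ q) , δ k ⟩    ≈⟨ difference ⟩
      ⟨ p , δ k ⟩ - ⟨ q , δ k ⟩   ≈⟨ +-cong (coeff≈pairing p k) (-‿cong (coeff≈pairing q k)) ⟨
      coeff p k - coeff q k       ≈⟨ +-congʳ (p≋q k) ⟩
      coeff q k - coeff q k       ≈⟨ -‿inverseʳ _ ⟩
      0#                          ∎)) (zeroˡ _)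

-- The polynomial ring.

module PolynomialRing {c ℓ : Level} (R : CommutativeRing c ℓ) where

  open CommutativeRing R hiding (ring; zero)
  open Polynomials R
  open Pairing R
  open Mult semiring using (×-congʳ; ×-congˡ; ×-homo-+; ×-assoc-*; ×-comm-*) renaming (_×_ to _·_)
  open SetoidReasoning setoid

  +ᵐ-assoc : ∀ {n} (k l m : Monomial n) → (k +ᵐ l) +ᵐ m ≡ k +ᵐ (l +ᵐ m)
  +ᵐ-assoc = Vec.zipWith-assoc ℕ.+-assoc

  +ᵐ-comm : ∀ {n} (k l : Monomial n) → k +ᵐ l ≡ l +ᵐ k
  +ᵐ-comm = Vec.zipWith-comm ℕ.+-comm

  +ᵐ-identityˡ : ∀ {n} (k : Monomial n) → 1ᵐ +ᵐ k ≡ k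
  +ᵐ-identityˡ = Vec.zipWith-identityˡ ℕ.+-identityˡ

  ⊕-cong : ∀ {n} {p p′ q q′ : Polynomial n} → p ≈ₚ p′ → q ≈ₚ q′ → p ⊕ q ≈ₚ p′ ⊕ q′
  ⊕-cong {p = p} {p′} p≋p′ q≋q′ = pairings λ φ →
    trans (pairing-⊕ p _) (trans (+-cong (pairing-≈ p≋p′ φ) (pairing-≈ q≋q′ φ)) (sym (pairing-⊕ p′ _)))

  ⊕-comm : ∀ {n} (p q : Polynomial n) → p ⊕ q ≈ₚ q ⊕ p
  ⊕-comm p q = pairings λ φ → trans (pairing-⊕ p q) (trans (+-comm _ _) (sym (pairing-⊕ q p)))

  ⊗-comm : ∀ {n} (p q : Polynomial n) → p ⊗ q ≈ₚ q ⊗ p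
  ⊗-comm p q = pairings λ φ → begin
    ⟨ p ⊗ q , φ ⟩                                  ≈⟨ pairing-⊗ p q ⟩
    ⟨ p , (λ k → ⟨ q , (λ l → φ (k +ᵐ l)) ⟩) ⟩     ≈⟨ pairing-swap p q ⟩
    ⟨ q , (λ l → ⟨ p , (λ k → φ (k +ᵐ l)) ⟩) ⟩     ≈⟨ pairing-cong q (λ l → pairing-cong p λ k → reflexive (≡.cong φ (+ᵐ-comm k l))) ⟩
    ⟨ q , (λ l → ⟨ p , (λ k → φ (l +ᵐ k)) ⟩) ⟩     ≈⟨ pairing-⊗ q p ⟨
    ⟨ q ⊗ p , φ ⟩                                  ∎

  ⊗-congˡ : ∀ {n} (p : Polynomial n) {q q′} → q ≈ₚ q′ → p ⊗ q ≈ₚ p ⊗ q′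
  ⊗-congˡ p {q} {q′} q≋q′ = pairings λ φ →
    trans (pairing-⊗ p q) (trans (pairing-cong p (λ k → pairing-≈ q≋q′ _)) (sym (pairing-⊗ p q′)))

  ≈ₚ-refl : ∀ {n} {p : Polynomial n} → p ≈ₚ p
  ≈ₚ-refl = pairings λ φ → refl

  ≈ₚ-sym : ∀ {n} {p q : Polynomial n} → p ≈ₚ q → q ≈ₚ p
  ≈ₚ-sym p≋q = pairings λ φ → sym (pairing-≈ p≋q φ)

  ≈ₚ-trans : ∀ {n} {p q r : Polynomial n} → p ≈ₚ q → q ≈ₚ r → p ≈ₚ r
  ≈ₚ-trans p≋q q≋r = pairings λ φ → trans (pairing-≈ p≋q φ) (pairing-≈ q≋r φ)

  ≈ₚ-reflexive : ∀ {n} {p q : Polynomial n} → p ≡ q → p ≈ₚ q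
  ≈ₚ-reflexive ≡.refl = ≈ₚ-refl

  ⊗-cong : ∀ {n} {p p′ q q′ : Polynomial n} → p ≈ₚ p′ → q ≈ₚ q′ → p ⊗ q ≈ₚ p′ ⊗ q′
  ⊗-cong {p = p} {p′} {q} {q′} p≋p′ q≋q′ =
    ≈ₚ-trans (⊗-congˡ p q≋q′) (≈ₚ-trans (⊗-comm p q′) (≈ₚ-trans (⊗-congˡ q′ p≋p′) (⊗-comm q′ p′)))

  ⊗-assoc : ∀ {n} (p q r : Polynomial n) → (p ⊗ q) ⊗ r ≈ₚ p ⊗ (q ⊗ r)
  ⊗-assoc p q r = pairings λ φ → begin
    ⟨ (p ⊗ q) ⊗ r , φ ⟩
      ≈⟨ trans (pairing-⊗ (p ⊗ q) r) (pairing-⊗ p q) ⟩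
    ⟨ p , (λ k → ⟨ q , (λ l → ⟨ r , (λ m → φ ((k +ᵐ l) +ᵐ m)) ⟩) ⟩) ⟩
      ≈⟨ pairing-cong p (λ k → pairing-cong q λ l → pairing-cong r λ m → reflexive (≡.cong φ (+ᵐ-assoc k l m))) ⟩
    ⟨ p , (λ k → ⟨ q , (λ l → ⟨ r , (λ m → φ (k +ᵐ (l +ᵐ m))) ⟩) ⟩) ⟩
      ≈⟨ pairing-cong p (λ k → pairing-⊗ q r) ⟨
    ⟨ p , (λ k → ⟨ q ⊗ r , (λ l → φ (k +ᵐ l)) ⟩) ⟩
      ≈⟨ pairing-⊗ p (q ⊗ r) ⟨
    ⟨ p ⊗ (q ⊗ r) , φ ⟩ ∎

  ⊗-distribʳ : ∀ {n} (r p q : Polynomial n) → (p ⊕ q) ⊗ r ≈ₚ p ⊗ r ⊕ q ⊗ r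
  ⊗-distribʳ r p q = pairings λ φ → begin
    ⟨ (p ⊕ q) ⊗ r , φ ⟩            ≈⟨ trans (pairing-⊗ (p ⊕ q) r) (pairing-⊕ p q) ⟩
    _                              ≈⟨ +-cong (pairing-⊗ p r) (pairing-⊗ q r) ⟨
    ⟨ p ⊗ r , φ ⟩ + ⟨ q ⊗ r , φ ⟩  ≈⟨ pairing-⊕ (p ⊗ r) (q ⊗ r) ⟨
    ⟨ p ⊗ r ⊕ q ⊗ r , φ ⟩          ∎

  const-⊗ : ∀ {n} a (p : Polynomial n) → const a ⊗ p ≈ₚ a ∙ p
  const-⊗ a p = pairings λ φ → begin
    ⟨ const a ⊗ p , φ ⟩                       ≈⟨ pairing-⊗ (const a) p ⟩
    a * ⟨ p , (λ l → φ (1ᵐ +ᵐ l)) ⟩ + 0#      ≈⟨ +-identityʳ _ ⟩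
    a * ⟨ p , (λ l → φ (1ᵐ +ᵐ l)) ⟩           ≈⟨ *-congˡ (pairing-cong p λ l → reflexive (≡.cong φ (+ᵐ-identityˡ l))) ⟩
    a * ⟨ p , φ ⟩                             ≈⟨ pairing-∙ a p ⟨
    ⟨ a ∙ p , φ ⟩                             ∎

  ∙-cong : ∀ {n} {a b} {p q : Polynomial n} → a ≈ b → p ≈ₚ q → a ∙ p ≈ₚ b ∙ q
  ∙-cong {a = a} {b} {p} {q} a≈b p≋q = pairings λ φ →
    trans (pairing-∙ a p) (trans (*-cong a≈b (pairing-≈ p≋q φ)) (sym (pairing-∙ b q)))

  1∙ : ∀ {n} (p : Polynomial n) → 1# ∙ p ≈ₚ p
  1∙ p = pairings λ φ → trans (pairing-∙ 1# p) (*-identityˡ _)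

  ∙-∙ : ∀ {n} a b (p : Polynomial n) → a ∙ (b ∙ p) ≈ₚ (a * b) ∙ p
  ∙-∙ a b p = pairings λ φ → begin
    ⟨ a ∙ (b ∙ p) , φ ⟩  ≈⟨ trans (pairing-∙ a (b ∙ p)) (*-congˡ (pairing-∙ b p)) ⟩
    a * (b * ⟨ p , φ ⟩)  ≈⟨ *-assoc a b _ ⟨
    (a * b) * ⟨ p , φ ⟩  ≈⟨ pairing-∙ (a * b) p ⟨
    ⟨ (a * b) ∙ p , φ ⟩  ∎

  ∙-⊗ : ∀ {n} a (p q : Polynomial n) → a ∙ (p ⊗ q) ≈ₚ (a ∙ p) ⊗ q
  ∙-⊗ a p q = ≈ₚ-trans (≈ₚ-sym (const-⊗ a (p ⊗ q))) (≈ₚ-trans (≈ₚ-sym (⊗-assoc (const a) p q)) (⊗-cong (const-⊗ a p) ≈ₚ-refl))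

  ⊗-∙ : ∀ {n} a (p q : Polynomial n) → p ⊗ (a ∙ q) ≈ₚ a ∙ (p ⊗ q)
  ⊗-∙ a p q = ≈ₚ-trans (⊗-comm p (a ∙ q)) (≈ₚ-trans (≈ₚ-sym (∙-⊗ a q p)) (∙-cong refl (⊗-comm q p)))

  ⊕-inverseʳ : ∀ {n} (p : Polynomial n) → p ⊕ (- 1# ∙ p) ≈ₚ []
  ⊕-inverseʳ p = pairings λ φ →
    trans (pairing-⊕ p _) (trans (+-congˡ (trans (pairing-∙ (- 1#) p) (-1*x≈-x _))) (-‿inverseʳ _))
    where open RingProperties (CommutativeRing.ring R) using (-1*x≈-x)

  isCommutativeRing-⊕-⊗ : ∀ n → IsCommutativeRing (_≈ₚ_ {n}) _⊕_ _⊗_ (- 1# ∙_) [] (const 1#)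
  isCommutativeRing-⊕-⊗ n = record
    { isRing = record
      { +-isAbelianGroup = record
        { isGroup = record
          { isMonoid = record
            { isSemigroup = record
              { isMagma = record
                { isEquivalence = record { refl = ≈ₚ-refl ; sym = ≈ₚ-sym ; trans = ≈ₚ-trans }
                ; ∙-cong = ⊕-cong
                }
              ; assoc = λ p q r → ≈ₚ-reflexive (List.++-assoc p q r)
              }
            ; identity = (λ p → ≈ₚ-refl) , (λ p → ≈ₚ-reflexive (List.++-identityʳ p))
            }
          ; inverse = (λ p → ≈ₚ-trans (⊕-comm (- 1# ∙ p) p) (⊕-inverseʳ p)) , ⊕-inverseʳ
          ; ⁻¹-cong = ∙-cong refl
          }
        ; comm = ⊕-comm
        }
      ; *-cong = ⊗-cong
      ; *-assoc = ⊗-assoc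
      ; *-identity = ⊗-identityˡ , λ p → ≈ₚ-trans (⊗-comm p (const 1#)) (⊗-identityˡ p)
      ; distrib = (λ r p q → ≈ₚ-trans (⊗-comm r (p ⊕ q)) (≈ₚ-trans (⊗-distribʳ r p q) (⊕-cong (⊗-comm p r) (⊗-comm q r))))
                , ⊗-distribʳ
      }
    ; *-comm = ⊗-comm
    }
    where
    ⊗-identityˡ : ∀ p → const 1# ⊗ p ≈ₚ p
    ⊗-identityˡ p = ≈ₚ-trans (const-⊗ 1# p) (1∙ p)

  polynomialRing : ℕ → CommutativeRing c (c ⊔ ℓ)
  polynomialRing n = record { isCommutativeRing = isCommutativeRing-⊕-⊗ n }

  coeff-⊕ : ∀ {n} (p q : Polynomial n) m → coeff (p ⊕ q) m ≈ coeff p m + coeff q m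
  coeff-⊕ p q m = trans (coeff≈pairing (p ⊕ q) m)
    (trans (pairing-⊕ p q) (sym (+-cong (coeff≈pairing p m) (coeff≈pairing q m))))

  coeff-∙ : ∀ {n} a (p : Polynomial n) m → coeff (a ∙ p) m ≈ a * coeff p m
  coeff-∙ a p m = trans (coeff≈pairing (a ∙ p) m) (trans (pairing-∙ a p) (*-congˡ (sym (coeff≈pairing p m))))

  -- The coefficient at `m` is a sum over the splittings of `m` into two exponent vectors, and each
  -- splitting has a vanishing factor. The bounds on degree and order of products both come from
  -- this.
  coeff-⊗-zero : ∀ {n} (p q : Polynomial n) m →
                 (∀ k l → k +ᵐ l ≡ m → coeff p k ≈ 0# ⊎ coeff q l ≈ 0#) → coeff (p ⊗ q) m ≈ 0#
  coeff-⊗-zero p q m vanish = trans (coeff≈pairing (p ⊗ q) m) (trans (pairing-⊗ p q)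
    -- The outer use runs over `p`. Its coefficient is moved inside the inner pairing, so that
    -- `pairing-zero` applies to `q` as well.
    (pairing-zero p λ k → trans (sym (pairing-*ʳ q (coeff p k))) (pairing-zero q (term k))))
    where
    term : ∀ k l → coeff q l * (coeff p k * δ m (k +ᵐ l)) ≈ 0#
    term k l with Vec.≡-dec ℕ._≟_ (k +ᵐ l) m
    ... | no k+l≢m = trans (*-congˡ (zeroʳ _)) (zeroʳ _)
    ... | yes k+l≡m with vanish k l k+l≡m
    ...   | inj₁ p≈0 = trans (*-congˡ (trans (*-congʳ p≈0) (zeroˡ _))) (zeroʳ _)
    ...   | inj₂ q≈0 = trans (*-congʳ q≈0) (zeroˡ _)

  -- Degree, order at the origin, and monomials.

  record Vanishes {n} (Z : Monomial n → Set) (p : Polynomial n) : Set ℓ where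
    constructor vanishing
    field coeff≈0 : ∀ m → Z m → coeff p m ≈ 0#

  open Vanishes public

  -- The bound on the degree is strict, so `Below 0` means zero; `Order d` is membership in the d-th
  -- power of the ideal of the origin. As instances of `Vanishes` both are closed under sums by a
  -- single proof.
  Below : ∀ {n} → ℕ → Polynomial n → Set ℓ
  Below d = Vanishes λ m → d ≤ Vec.sum m

  Order : ∀ {n} → ℕ → Polynomial n → Set ℓ
  Order d = Vanishes λ m → Vec.sum m < d

  module _ {n : ℕ} {Z : Monomial n → Set} where

    vanishes-resp : ∀ {p q} → p ≈ₚ q → Vanishes Z p → Vanishes Z q
    vanishes-resp p≈q Zp = vanishing λ m z → trans (sym (≈ₚ⇒≋ p≈q m)) (coeff≈0 Zp m z)

    vanishes-⊕ : ∀ {p q} → Vanishes Z p → Vanishes Z q → Vanishes Z (p ⊕ q)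
    vanishes-⊕ {p} {q} Zp Zq = vanishing λ m z →
      trans (coeff-⊕ p q m) (trans (+-cong (coeff≈0 Zp m z) (coeff≈0 Zq m z)) (+-identityʳ 0#))

    open CommutativeMonoidSum (CommutativeRing.+-commutativeMonoid (polynomialRing n)) using () renaming (sum to ∑)

    vanishes-∑ : ∀ {k} (f : Fin k → Polynomial n) → (∀ i → Vanishes Z (f i)) → Vanishes Z (∑ f)
    vanishes-∑ {zero}  f Zf = vanishing λ m z → refl
    vanishes-∑ {suc k} f Zf = vanishes-⊕ (Zf zero) (vanishes-∑ (f ∘ suc) (Zf ∘ suc))

  sum-+ᵐ : ∀ {n} (k l : Monomial n) → Vec.sum (k +ᵐ l) ≡ Vec.sum k ℕ+ Vec.sum l
  sum-+ᵐ Vec.[] Vec.[] = ≡.refl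
  sum-+ᵐ (a Vec.∷ k) (b Vec.∷ l) =
    ≡.trans (≡.cong (a ℕ+ b ℕ+_) (sum-+ᵐ k l)) (ℕ+-interchange a b (Vec.sum k) (Vec.sum l))
    where open CommutativeSemigroupProperties ℕ.+-commutativeSemigroup using () renaming (interchange to ℕ+-interchange)

  sum-1ᵐ : ∀ n → Vec.sum (1ᵐ {n}) ≡ 0
  sum-1ᵐ zero    = ≡.refl
  sum-1ᵐ (suc n) = sum-1ᵐ n

  order-⊗ : ∀ {n d e} {p q : Polynomial n} → Order d p → Order e q → Order (d ℕ+ e) (p ⊗ q)
  order-⊗ {d = d} {e} {p} {q} dp eq = vanishing λ m m<d+e → coeff-⊗-zero p q m (split m m<d+e)
    where
    split : ∀ m → Vec.sum m < d ℕ+ e → ∀ k l → k +ᵐ l ≡ m → coeff p k ≈ 0# ⊎ coeff q l ≈ 0#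
    split m m<d+e k l ≡.refl with Vec.sum k ℕ.<? d | Vec.sum l ℕ.<? e
    ... | yes k<d | _       = inj₁ (coeff≈0 dp k k<d)
    ... | no _    | yes l<e = inj₂ (coeff≈0 eq l l<e)
    ... | no k≮d  | no l≮e  = contradiction
      (≡.subst (_< d ℕ+ e) (sum-+ᵐ k l) m<d+e) (ℕ.≤⇒≯ (ℕ.+-mono-≤ (ℕ.≮⇒≥ k≮d) (ℕ.≮⇒≥ l≮e)))

  -- One strict bound, degree below `d`, and one weak bound, degree at most `e`, add without loss;
  -- this includes `d = 0`, where `p` is zero.
  below-⊗ : ∀ {n d e} {p q : Polynomial n} → Below d p → Below (suc e) q → Below (d ℕ+ e) (p ⊗ q)
  below-⊗ {d = d} {e} {p} {q} dp eq = vanishing λ m d+e≤m → coeff-⊗-zero p q m (split m d+e≤m)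
    where
    split : ∀ m → d ℕ+ e ≤ Vec.sum m → ∀ k l → k +ᵐ l ≡ m → coeff p k ≈ 0# ⊎ coeff q l ≈ 0#
    split m d+e≤m k l ≡.refl with d ℕ.≤? Vec.sum k | suc e ℕ.≤? Vec.sum l
    ... | yes d≤k | _       = inj₁ (coeff≈0 dp k d≤k)
    ... | no _    | yes e<l = inj₂ (coeff≈0 eq l e<l)
    ... | no d≰k  | no e≮l  = contradiction
      (≡.subst (d ℕ+ e ≤_) (sum-+ᵐ k l) d+e≤m) (ℕ.<⇒≱ (ℕ.+-mono-<-≤ (ℕ.≰⇒> d≰k) (ℕ.≮⇒≥ e≮l)))

  below-mono : ∀ {n d e} {p : Polynomial n} → d ≤ e → Below d p → Below e p
  below-mono d≤e dp = vanishing λ m e≤m → coeff≈0 dp m (ℕ.≤-trans d≤e e≤m)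

  order-0 : ∀ {n} {p : Polynomial n} → Order 0 p
  order-0 = vanishing λ m ()

  X : ∀ {n} → Monomial n → Polynomial n
  X k = [ 1# , k ]

  coeff-X : ∀ {n} (k m : Monomial n) → coeff (X k) m ≈ δ m k
  coeff-X k m = +-identityʳ _

  X-⊗ : ∀ {n} (k l : Monomial n) → X k ⊗ X l ≈ₚ X (k +ᵐ l)
  X-⊗ k l = pairings λ φ → +-congʳ (*-congʳ (*-identityʳ 1#))

  below-X : ∀ {n} (k : Monomial n) → Below (suc (Vec.sum k)) (X k)
  below-X k = vanishing λ m k<m → trans (coeff-X k m) (δ-≢ {m = m} {k} λ where ≡.refl → ℕ.n≮n _ k<m)

  below-const : ∀ {n} a → Below 1 (const {n} a)
  below-const {n} a = vanishing zero-above
    where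
    zero-above : ∀ m → 1 ≤ Vec.sum m → coeff (const a) m ≈ 0#
    zero-above m 0<m with Vec.≡-dec ℕ._≟_ 1ᵐ m
    ... | yes ≡.refl = contradiction (≡.subst (1 ≤_) (sum-1ᵐ n) 0<m) ℕ.n≮0
    ... | no _       = +-identityʳ 0#

  x^ : ∀ {n} → Fin n → ℕ → Monomial n
  x^ i e = 1ᵐ Vec.[ i ]≔ e

  sum-x^ : ∀ {n} (i : Fin n) e → Vec.sum (x^ i e) ≡ e
  sum-x^ {suc n} zero    e = ≡.trans (≡.cong (e ℕ+_) (sum-1ᵐ n)) (ℕ.+-identityʳ e)
  sum-x^ {suc n} (suc i) e = sum-x^ i e

  x^-+ : ∀ {n} (i : Fin n) d e → x^ i d +ᵐ x^ i e ≡ x^ i (d ℕ+ e)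
  x^-+ zero    d e = ≡.cong (d ℕ+ e Vec.∷_) (+ᵐ-identityˡ _)
  x^-+ (suc i) d e = ≡.cong (0 Vec.∷_) (x^-+ i d e)

  x^-0 : ∀ {n} (i : Fin n) → x^ i 0 ≡ 1ᵐ
  x^-0 zero    = ≡.refl
  x^-0 (suc i) = ≡.cong (0 Vec.∷_) (x^-0 i)

  var-↑ : ∀ {n} (i : Fin n) e → var i ↑ e ≈ₚ X (x^ i e)
  var-↑ i zero    = ≈ₚ-reflexive (≡.cong X (≡.sym (x^-0 i)))
  var-↑ i (suc e) = ≈ₚ-trans (⊗-congˡ (var i) (var-↑ i e))
    (≈ₚ-trans (X-⊗ (x^ i 1) (x^ i e)) (≈ₚ-reflexive (≡.cong X (x^-+ i 1 e))))

  -- Formal partial derivatives.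

  ∂ : ∀ {n} → Fin n → Polynomial n → Polynomial n
  ∂ i = map λ (a , k) → Vec.lookup k i · a , Vec.updateAt k i pred

  -- Differentiation is the adjoint of an operator on `φ`, and therefore respects `_≈ₚ_`. At
  -- exponent zero `pred` leaves the monomial unchanged, but the factor in front is zero.
  pairing-∂ : ∀ {n} i (p : Polynomial n) {φ} →
              ⟨ ∂ i p , φ ⟩ ≈ ⟨ p , (λ k → Vec.lookup k i · φ (Vec.updateAt k i pred)) ⟩
  pairing-∂ i []            = refl
  pairing-∂ i ((a , k) ∷ p) = +-cong
    (trans (×-assoc-* (Vec.lookup k i) a _) (sym (×-comm-* (Vec.lookup k i) a _))) (pairing-∂ i p)

  ∂-cong : ∀ {n} i {p q : Polynomial n} → p ≈ₚ q → ∂ i p ≈ₚ ∂ i q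
  ∂-cong i {p} {q} p≋q = pairings λ φ →
    trans (pairing-∂ i p) (trans (pairing-≈ p≋q _) (sym (pairing-∂ i q)))

  ∂-⊕ : ∀ {n} i (p q : Polynomial n) → ∂ i (p ⊕ q) ≈ₚ ∂ i p ⊕ ∂ i q
  ∂-⊕ i p q = ≈ₚ-reflexive (List.map-++ _ p q)

  private
    pairing-·ʳ : ∀ {n} (p : Polynomial n) {φ} d → ⟨ p , (λ k → d · φ k) ⟩ ≈ d · ⟨ p , φ ⟩
    pairing-·ʳ p zero    = pairing-0ʳ p
    pairing-·ʳ p (suc d) = trans (pairing-+ʳ p) (+-congˡ (pairing-·ʳ p d))

    updateAt-+ᵐ : ∀ {n} i (k l : Monomial n) {d} → Vec.lookup k i ≡ suc d →
                  Vec.updateAt (k +ᵐ l) i pred ≡ Vec.updateAt k i pred +ᵐ l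
    updateAt-+ᵐ zero    (suc _ Vec.∷ k) (b Vec.∷ l) _  = ≡.refl
    updateAt-+ᵐ (suc i) (a Vec.∷ k)     (b Vec.∷ l) eq = ≡.cong (a ℕ+ b Vec.∷_) (updateAt-+ᵐ i k l eq)

    -- If the variable `i` is absent from `k`, the two arguments of `φ` may differ, but both sides
    -- are zero multiples.
    ∂-term : ∀ {n} i (k l : Monomial n) (φ : Monomial n → Carrier) →
             Vec.lookup k i · φ (Vec.updateAt (k +ᵐ l) i pred) ≈
             Vec.lookup k i · φ (Vec.updateAt k i pred +ᵐ l)
    ∂-term i k l φ with Vec.lookup k i in eq
    ... | zero  = refl
    ... | suc d = ×-congʳ (suc d) (reflexive (≡.cong φ (updateAt-+ᵐ i k l eq)))

  ∂-⊗ : ∀ {n} i (p q : Polynomial n) → ∂ i (p ⊗ q) ≈ₚ ∂ i p ⊗ q ⊕ p ⊗ ∂ i q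
  ∂-⊗ i p q = pairings λ φ → begin
    ⟨ ∂ i (p ⊗ q) , φ ⟩
      ≈⟨ trans (pairing-∂ i (p ⊗ q)) (pairing-⊗ p q) ⟩
    ⟨ p , (λ k → ⟨ q , (λ l → Vec.lookup (k +ᵐ l) i · φ (Vec.updateAt (k +ᵐ l) i pred)) ⟩) ⟩
      ≈⟨ pairing-cong p (λ k → pairing-cong q (term φ k)) ⟩
    ⟨ p , (λ k → ⟨ q , (λ l → Vec.lookup k i · φ (Vec.updateAt k i pred +ᵐ l) +
                             Vec.lookup l i · φ (k +ᵐ Vec.updateAt l i pred)) ⟩) ⟩
      ≈⟨ trans (pairing-cong p (λ k → pairing-+ʳ q)) (pairing-+ʳ p) ⟩
    ⟨ p , (λ k → ⟨ q , (λ l → Vec.lookup k i · φ (Vec.updateAt k i pred +ᵐ l)) ⟩) ⟩ +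
    ⟨ p , (λ k → ⟨ q , (λ l → Vec.lookup l i · φ (k +ᵐ Vec.updateAt l i pred)) ⟩) ⟩
      ≈⟨ +-cong (trans (pairing-⊗ (∂ i p) q) (trans (pairing-∂ i p) (sym (pairing-cong p λ k → pairing-·ʳ q (Vec.lookup k i)))))
                (trans (pairing-⊗ p (∂ i q)) (pairing-cong p λ k → pairing-∂ i q)) ⟨
    ⟨ ∂ i p ⊗ q , φ ⟩ + ⟨ p ⊗ ∂ i q , φ ⟩
      ≈⟨ pairing-⊕ (∂ i p ⊗ q) _ ⟨
    ⟨ ∂ i p ⊗ q ⊕ p ⊗ ∂ i q , φ ⟩ ∎
    where
    term : ∀ φ k l → Vec.lookup (k +ᵐ l) i · φ (Vec.updateAt (k +ᵐ l) i pred) ≈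
           Vec.lookup k i · φ (Vec.updateAt k i pred +ᵐ l) + Vec.lookup l i · φ (k +ᵐ Vec.updateAt l i pred)
    term φ k l = begin
      Vec.lookup (k +ᵐ l) i · φ (Vec.updateAt (k +ᵐ l) i pred)
        ≈⟨ ×-congˡ (Vec.lookup-zipWith _ℕ+_ i k l) ⟩
      (Vec.lookup k i ℕ+ Vec.lookup l i) · φ (Vec.updateAt (k +ᵐ l) i pred)
        ≈⟨ ×-homo-+ _ (Vec.lookup k i) (Vec.lookup l i) ⟩
      Vec.lookup k i · φ (Vec.updateAt (k +ᵐ l) i pred) + Vec.lookup l i · φ (Vec.updateAt (k +ᵐ l) i pred)
        ≈⟨ +-cong (∂-term i k l φ)
                  (trans (×-congʳ (Vec.lookup l i) (reflexive (≡.cong (λ m → φ (Vec.updateAt m i pred)) (+ᵐ-comm k l))))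
                  (trans (∂-term i l k φ)
                         (×-congʳ (Vec.lookup l i) (reflexive (≡.cong φ (+ᵐ-comm _ k)))))) ⟩
      Vec.lookup k i · φ (Vec.updateAt k i pred +ᵐ l) + Vec.lookup l i · φ (k +ᵐ Vec.updateAt l i pred) ∎

  below-∂ : ∀ {n d} i {p : Polynomial n} → Below (suc d) p → Below d (∂ i p)
  below-∂ {d = d} i {p} dp = vanishing λ m d≤m →
    trans (coeff≈pairing (∂ i p) m) (trans (pairing-∂ i p) (pairing-zero p (vanish m d≤m)))
    where
    sum-updateAt : ∀ {n} i (k : Monomial n) {e} → Vec.lookup k i ≡ suc e →
                   Vec.sum k ≡ suc (Vec.sum (Vec.updateAt k i pred))
    sum-updateAt zero    (suc _ Vec.∷ k) _  = ≡.refl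
    sum-updateAt (suc i) (a Vec.∷ k)     eq =
      ≡.trans (≡.cong (a ℕ+_) (sum-updateAt i k eq)) (ℕ.+-suc a _)
    vanish : ∀ m → d ≤ Vec.sum m → ∀ k → coeff p k * (Vec.lookup k i · δ m (Vec.updateAt k i pred)) ≈ 0#
    vanish m d≤m k with Vec.lookup k i in eq
    ... | zero  = zeroʳ _
    ... | suc e with Vec.≡-dec ℕ._≟_ (Vec.updateAt k i pred) m
    ...   | yes ≡.refl = trans (*-congʳ (coeff≈0 dp k (≡.subst (suc d ≤_) (≡.sym (sum-updateAt i k eq)) (s≤s d≤m)))) (zeroˡ _)
    ...   | no _       = trans (*-congˡ (·0 (suc e))) (zeroʳ _)
      where
      ·0 : ∀ d → d · 0# ≈ 0#
      ·0 zero    = refl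
      ·0 (suc d) = trans (+-identityˡ _) (·0 d)

  module _ {n : ℕ} where

    open CommutativeMonoidSum (CommutativeRing.+-commutativeMonoid (polynomialRing n)) using () renaming (sum to ∑)
    open SumSingle (CommutativeRing.+-commutativeMonoid (polynomialRing n)) using (sum-single)

    sum-tabulate : ∀ {k} (f : Fin k → Polynomial n) → sum (tabulate f) ≡ ∑ f
    sum-tabulate {zero}  f = ≡.refl
    sum-tabulate {suc k} f = ≡.cong (f zero ⊕_) (sum-tabulate (f ∘ suc))

    sum-allFin : ∀ {k} (f : Fin k → Polynomial n) → sum (map f (allFin k)) ≈ₚ ∑ f
    sum-allFin f = ≈ₚ-reflexive (≡.trans (≡.cong sum (List.map-tabulate id f)) (sum-tabulate f))

    ∂-∑ : ∀ {k} i (f : Fin k → Polynomial n) → ∂ i (∑ f) ≈ₚ ∑ (λ j → ∂ i (f j))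
    ∂-∑ {zero}  i f = ≈ₚ-refl {p = []}
    ∂-∑ {suc k} i f = ≈ₚ-trans (∂-⊕ i (f zero) _) (⊕-cong (≈ₚ-refl {p = ∂ i (f zero)}) (∂-∑ i (f ∘ suc)))

    -- Only the `i`-th summand involves the variable `i`. The exponent comes out as a field element,
    -- and this is where the characteristic enters.
    ∂-powerSum : ∀ i e → ∂ i (powerSum n (suc e)) ≈ₚ (suc e · 1#) ∙ X (x^ i e)
    ∂-powerSum i e =
      ≈ₚ-trans (∂-cong i (sum-allFin (λ j → var j ↑ suc e)))
      (≈ₚ-trans (∂-∑ i (λ j → var j ↑ suc e))
      (≈ₚ-trans (sum-single (λ j → ∂ i (var j ↑ suc e)) i λ j j≢i → ≈ₚ-trans (∂-cong i (var-↑ j (suc e))) (off j j≢i))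
      (≈ₚ-trans (∂-cong i (var-↑ i (suc e))) diagonal)))
      where
      off : ∀ j → j ≢ i → ∂ i (X (x^ j (suc e))) ≈ₚ []
      off j j≢i = pairings λ φ → trans (+-identityʳ _) (trans (*-congʳ (trans
        (×-congˡ {1#} (≡.trans (Vec.lookup∘updateAt′ i j (j≢i ∘ ≡.sym) 1ᵐ) (Vec.lookup-replicate i 0))) refl)) (zeroˡ _))
      diagonal : ∂ i (X (x^ i (suc e))) ≈ₚ (suc e · 1#) ∙ X (x^ i e)
      diagonal = pairings λ φ → +-congʳ (*-cong
        (trans (×-congˡ {1#} (Vec.lookup∘updateAt i 1ᵐ)) (sym (*-identityʳ _)))
        (reflexive (≡.cong φ (Vec.updateAt-updateAt-local i 1ᵐ ≡.refl))))

-- Homogeneous linear systems over a Heyting field.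

module Elimination {c ℓ₁ ℓ₂ : Level} (F : HeytingField c ℓ₁ ℓ₂) where

  open HeytingField F using (_#_; #⇒invertible; tight)
  open CommutativeRing (ring F) hiding (zero; ring)
  open RingProperties (CommutativeRing.ring (ring F)) using (-‿distribˡ-*; -‿distribʳ-*; -0#≈0#)
  open CommutativeSemigroupProperties *-commutativeSemigroup using (x∙yz≈y∙xz)
  open SemiringSum semiring using (sum; ∑-distrib-+; sum-cong-≋; sum-replicate-zero; *-distribˡ-sum)
  open SetoidReasoning setoid

  #0⇒inverse : ∀ {x} → x # 0# → ∃[ u ] u * x ≈ 1#
  #0⇒inverse x#0 with u , u*[x-0]≈1 , _ ← #⇒invertible x#0 =
    u , trans (*-congˡ (sym (trans (+-congˡ -0#≈0#) (+-identityʳ _)))) u*[x-0]≈1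

  ¬#0⇒≈0 : ∀ {x} → ¬ x # 0# → x ≈ 0#
  ¬#0⇒≈0 = proj₁ (tight _ _)

  private
    punch-cases : ∀ {m p} {P : Fin (suc m) → Set p} (i i′ : Fin (suc m)) → P i → (∀ l → P (Fin.punchIn i l)) → P i′
    punch-cases {P = P} i i′ Pi Pl with i Fin.≟ i′
    ... | yes ≡.refl = Pi
    ... | no i≢i′    = ≡.subst P (Fin.punchIn-punchOut i≢i′) (Pl (Fin.punchOut i≢i′))

  -- Fraction-free Gaussian elimination on the first column.
  nontrivial-solution : ∀ {M N} → ¬ (1# ≈ 0#) → M < N → (A : Fin M → Fin N → Carrier) →
    ¬ ¬ (∃ λ (x : Fin N → Carrier) → ¬ (∀ j → x j ≈ 0#) × (∀ i → sum (λ j → A i j * x j) ≈ 0#))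
  nontrivial-solution {zero}  {suc N} 1≉0 _         A k = k ((λ _ → 1#) , (λ x≈0 → 1≉0 (x≈0 zero)) , λ ())
  -- Whether the first column has an invertible entry need not be decidable, but the doubly negated
  -- conclusion permits the case distinction. Without a pivot the column is zero and the first unit
  -- vector is a solution.
  nontrivial-solution {suc M} {suc N} 1≉0 (s≤s M<N) A k = ¬¬-excluded-middle λ where
    (no no-pivot) → k (1# VecF.∷ (λ _ → 0#) , (λ x≈0 → 1≉0 (x≈0 zero)) , λ i → begin
      A i zero * 1# + sum (λ j → A i (suc j) * 0#)
        ≈⟨ +-cong (trans (*-identityʳ _) (¬#0⇒≈0 λ Ai0#0 → no-pivot (i , Ai0#0)))
                  (trans (sum-cong-≋ λ j → zeroʳ (A i (suc j))) (sum-replicate-zero N)) ⟩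
      0# + 0#
        ≈⟨ +-identityʳ 0# ⟩
      0# ∎)
    (yes (i , r₀#0)) →
      let r₀ = A i zero
          r  = A i ∘ suc
          A′ : Fin M → Fin N → Carrier
          A′ = λ i′ j → r₀ * A (Fin.punchIn i i′) (suc j) + - (A (Fin.punchIn i i′) zero) * r j
      in nontrivial-solution 1≉0 M<N A′ λ (x′ , x′≉0 , A′x′≈0) →
      let S = sum λ j → r j * x′ j
          -- Back substitution scaled by `r₀`: the first coordinate is chosen to solve the pivot
          -- row, and invertibility of `r₀` keeps the solution nontrivial.
          x : Fin (suc N) → Carrier
          x = (- S) VecF.∷ (λ j → r₀ * x′ j)
          u , ur₀≈1 = #0⇒inverse r₀#0
          tail-sum : ∀ i′ → sum (λ j → A i′ (suc j) * (r₀ * x′ j)) ≈ r₀ * sum (λ j → A i′ (suc j) * x′ j)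
          tail-sum i′ = trans (sum-cong-≋ λ j → x∙yz≈y∙xz (A i′ (suc j)) r₀ (x′ j)) (sym (*-distribˡ-sum r₀ (λ j → A i′ (suc j) * x′ j)))
          pivot-row : r₀ * (- S) + sum (λ j → r j * (r₀ * x′ j)) ≈ 0#
          pivot-row = trans (+-cong (sym (-‿distribʳ-* r₀ S)) (tail-sum i)) (-‿inverseˡ _)
          other-row : ∀ i′ → let a = A (Fin.punchIn i i′) in a zero * (- S) + sum (λ j → a (suc j) * (r₀ * x′ j)) ≈ 0#
          other-row i′ = let a = A (Fin.punchIn i i′) in begin
            a zero * (- S) + sum (λ j → a (suc j) * (r₀ * x′ j))
              ≈⟨ +-congʳ (trans (sym (-‿distribʳ-* _ S)) (trans (-‿distribˡ-* _ S) (*-distribˡ-sum (- a zero) (λ j → r j * x′ j)))) ⟩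
            sum (λ j → - a zero * (r j * x′ j)) + sum (λ j → a (suc j) * (r₀ * x′ j))
              ≈⟨ +-comm _ _ ⟩
            sum (λ j → a (suc j) * (r₀ * x′ j)) + sum (λ j → - a zero * (r j * x′ j))
              ≈⟨ ∑-distrib-+ (λ j → a (suc j) * (r₀ * x′ j)) _ ⟨
            sum (λ j → a (suc j) * (r₀ * x′ j) + - a zero * (r j * x′ j))
              ≈⟨ sum-cong-≋ (λ j → trans (+-cong (trans (x∙yz≈y∙xz (a (suc j)) r₀ (x′ j)) (sym (*-assoc r₀ _ _)))
                                                 (sym (*-assoc (- a zero) (r j) _)))
                                         (sym (distribʳ (x′ j) _ _))) ⟩
            sum (λ j → A′ i′ j * x′ j)
              ≈⟨ A′x′≈0 i′ ⟩
            0# ∎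
          solves : ∀ i′ → sum (λ j → A i′ j * x j) ≈ 0#
          solves i′ = punch-cases i i′ pivot-row other-row
      in k (x , (λ x≈0 → x′≉0 λ j → begin
              x′ j               ≈⟨ *-identityˡ _ ⟨
              1# * x′ j          ≈⟨ *-congʳ ur₀≈1 ⟨
              u * r₀ * x′ j      ≈⟨ *-assoc _ _ _ ⟩
              u * (r₀ * x′ j)    ≈⟨ *-congˡ (x≈0 (suc j)) ⟩
              u * 0#             ≈⟨ zeroʳ u ⟩
              0#                 ∎) , solves)

-- Exponent vectors in a box.

module Boxes where

  -- The exponents are the base-`b` digits of `j`, so the index type already carries the number of
  -- monomials in the box.
  boxVec : ∀ {n} b → Fin (b ^ n) → Vec ℕ n
  boxVec b j = Vec.tabulate (Fin.toℕ ∘ Fin.finToFun j)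

  private
    -- Takes the place of function extensionality.
    funToFin-cong : ∀ {m n} {f g : Fin m → Fin n} → f ≗ g → Fin.funToFin f ≡ Fin.funToFin g
    funToFin-cong {zero}  f≗g = ≡.refl
    funToFin-cong {suc m} f≗g = ≡.cong₂ Fin.combine (f≗g zero) (funToFin-cong (f≗g ∘ suc))

  boxVec-injective : ∀ {n} b {i j : Fin (b ^ n)} → boxVec {n} b i ≡ boxVec b j → i ≡ j
  boxVec-injective {n} b {i} {j} eq =
    ≡.trans (≡.sym (Fin.funToFin-finToFin {n} i)) (≡.trans (funToFin-cong λ l → Fin.toℕ-injective
      (≡.trans (≡.sym (Vec.lookup∘tabulate _ l)) (≡.trans (≡.cong (λ v → Vec.lookup v l) eq) (Vec.lookup∘tabulate _ l))))
      (Fin.funToFin-finToFin {n} j))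

  boxVec-surjective : ∀ {n} b (k : Vec ℕ n) → (∀ i → Vec.lookup k i < b) → ∃[ j ] boxVec b j ≡ k
  boxVec-surjective b k k<b = Fin.funToFin (λ i → Fin.fromℕ< (k<b i)) ,
    ≡.trans (Vec.tabulate-cong λ i → ≡.trans (≡.cong Fin.toℕ (Fin.finToFun-funToFin _ i)) (Fin.toℕ-fromℕ< (k<b i)))
            (Vec.tabulate∘lookup k)

  -- Every entry is below `b`; the total is strictly bounded because there is at least one
  -- coordinate.
  sum-boxVec : ∀ {n} b (j : Fin (b ^ suc n)) → Vec.sum (boxVec {suc n} b j) < suc n ℕ* b
  sum-boxVec {n} b j = sum-tabulate n (Fin.finToFun j)
    where
    sum-tabulate : ∀ n (f : Fin (suc n) → Fin b) → Vec.sum (Vec.tabulate (Fin.toℕ ∘ f)) < suc n ℕ* b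
    sum-tabulate zero    f = ℕ.+-monoˡ-< 0 (Fin.toℕ<n (f zero))
    sum-tabulate (suc n) f = ℕ.+-mono-< (Fin.toℕ<n (f zero)) (sum-tabulate n (f ∘ suc))

-- Linear spans of polynomials and the ideal of the factors.

module Spans {c ℓ : Level} (R : CommutativeRing c ℓ) where

  open CommutativeRing R hiding (ring; zero)
  open Polynomials R
  open Pairing R
  open PolynomialRing R
  open Mult semiring using () renaming (_×_ to _·_)

  -- Generators are given by a predicate rather than a list, so that all multiples of a polynomial,
  -- or all polynomials of order `d`, can be among them.
  data Span {n s} (S : Polynomial n → Set s) : Polynomial n → Set (c ⊔ ℓ ⊔ s) where
    member : ∀ {p} → S p → Span S p
    null   : Span S []
    add    : ∀ {p q} → Span S p → Span S q → Span S (p ⊕ q)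
    scale  : ∀ a {p} → Span S p → Span S (a ∙ p)
    resp   : ∀ {p q} → p ≈ₚ q → Span S p → Span S q

  module _ {n : ℕ} where

    private module P = CommutativeRing (polynomialRing n)

    span-bind : ∀ {s t} {S : Polynomial n → Set s} {T : Polynomial n → Set t} →
                (∀ {p} → S p → Span T p) → ∀ {p} → Span S p → Span T p
    span-bind f (member Sp)  = f Sp
    span-bind f null         = null
    span-bind f (add Sp Sq)  = add (span-bind f Sp) (span-bind f Sq)
    span-bind f (scale a Sp) = scale a (span-bind f Sp)
    span-bind f (resp eq Sp) = resp eq (span-bind f Sp)

    span-⊗ : ∀ {s t} {S : Polynomial n → Set s} {T : Polynomial n → Set t} g →
             (∀ {p} → S p → Span T (g ⊗ p)) → ∀ {p} → Span S p → Span T (g ⊗ p)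
    span-⊗ g f (member Sp)          = f Sp
    span-⊗ g f null                 = resp (P.sym (P.zeroʳ g)) null
    span-⊗ g f (add {p} {q} Sp Sq)  = resp (P.sym (P.distribˡ g p q)) (add (span-⊗ g f Sp) (span-⊗ g f Sq))
    span-⊗ g f (scale a {p} Sp)     = resp (P.sym (⊗-∙ a g p)) (scale a (span-⊗ g f Sp))
    span-⊗ g f (resp eq Sp)         = resp (⊗-congˡ g eq) (span-⊗ g f Sp)

    span-terms : ∀ {s} {S : Polynomial n → Set s} {p} → All (λ (_ , k) → Span S (X k)) p → Span S p
    span-terms []       = null
    span-terms {p = (a , k) ∷ p} (Sk ∷ Sp) =
      resp (pairings λ φ → +-congʳ (*-congʳ (*-identityʳ a))) (add (scale a Sk) (span-terms Sp))

    truncate : ℕ → Polynomial n → Polynomial n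
    truncate d = filter λ (_ , k) → Vec.sum k ℕ.<? d

    -- A formal sum of degree below `d` may still list terms of higher degree that cancel. Deleting
    -- them does not change the polynomial, and makes induction over the remaining terms possible.
    truncate-below : ∀ {d p} → Below d p → truncate d p ≈ₚ p
    truncate-below {d} {p} dp = pairings λ φ → sym (begin
      ⟨ p , φ ⟩                               ≈⟨ pairing-cong p (λ k → split φ k) ⟩
      ⟨ p , (λ k → low φ k + high φ k) ⟩      ≈⟨ pairing-+ʳ p ⟩
      ⟨ p , low φ ⟩ + ⟨ p , high φ ⟩          ≈⟨ +-cong (pairing-low φ p) (pairing-zero p (high-zero φ)) ⟩
      ⟨ truncate d p , φ ⟩ + 0#               ≈⟨ +-identityʳ _ ⟩
      ⟨ truncate d p , φ ⟩                    ∎)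
      where
      open SetoidReasoning setoid
      low high : (Monomial n → Carrier) → Monomial n → Carrier
      low φ k = if Vec.sum k <ᵇ d then φ k else 0#
      high φ k = if Vec.sum k <ᵇ d then 0# else φ k
      split : ∀ φ k → φ k ≈ low φ k + high φ k
      split φ k with Vec.sum k <ᵇ d
      ... | true  = sym (+-identityʳ _)
      ... | false = sym (+-identityˡ _)
      high-zero : ∀ φ k → coeff p k * high φ k ≈ 0#
      high-zero φ k with Vec.sum k <ᵇ d in eq
      ... | true  = zeroʳ _
      ... | false = trans (*-congʳ (coeff≈0 dp k (ℕ.≮⇒≥ λ k<d → ≡.subst T eq (ℕ.<⇒<ᵇ k<d)))) (zeroˡ _)
      pairing-low : ∀ φ q → ⟨ q , low φ ⟩ ≈ ⟨ truncate d q , φ ⟩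
      pairing-low φ []            = refl
      pairing-low φ ((a , k) ∷ q) with Vec.sum k <ᵇ d
      ... | true  = +-congˡ (pairing-low φ q)
      ... | false = trans (+-congʳ (zeroʳ a)) (trans (+-identityˡ _) (pairing-low φ q))

    span-below : ∀ {s} {S : Polynomial n → Set s} {d p} → Below d p →
                 (∀ k → Vec.sum k < d → Span S (X k)) → Span S p
    span-below {d = d} {p} dp SX =
      resp (truncate-below dp) (span-terms (All.map (λ {t} → SX (proj₂ t)) (All.all-filter (λ (_ , k) → Vec.sum k ℕ.<? d) p)))

    sumProducts : List (Polynomial n × Polynomial n) → Polynomial n
    sumProducts L = sum (map (λ (P , Q) → P ⊗ Q) L)

    factors : List (Polynomial n × Polynomial n) → List (Polynomial n)
    factors []            = []
    factors ((P , Q) ∷ L) = P ∷ Q ∷ factors L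

    -- Generates the sum of the space of box monomials and the ideal of `gs`; the arbitrary cofactor
    -- `h` turns linear combinations into ideal elements.
    data BoxOrMultiple (b : ℕ) (gs : List (Polynomial n)) : Polynomial n → Set c where
      box      : ∀ k → (∀ i → Vec.lookup k i < b) → BoxOrMultiple b gs (X k)
      multiple : ∀ {g} → g ∈ gs → ∀ h → BoxOrMultiple b gs (g ⊗ h)

    -- By the product rule every term of the derivative still contains `P` or `Q`, so it lies in the
    -- ideal of the factors. The list `gs` stays fixed while `L` shrinks in the recursion.
    span-∂-sumProducts : ∀ {b gs} i L h → (∀ {g} → g ∈ factors L → g ∈ gs) →
                         Span (BoxOrMultiple b gs) (∂ i (sumProducts L) ⊗ h)
    span-∂-sumProducts i []            h L⊆gs = null
    span-∂-sumProducts i ((P , Q) ∷ L) h L⊆gs =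
      resp (P.sym expand)
        (add (add (member (multiple (L⊆gs (there (here ≡.refl))) (∂ i P ⊗ h)))
                  (member (multiple (L⊆gs (here ≡.refl)) (∂ i Q ⊗ h))))
             (span-∂-sumProducts i L h (L⊆gs ∘ there ∘ there)))
      where
      open CommutativeSemigroupProperties P.*-commutativeSemigroup using (xy∙z≈y∙xz)
      expand : ∂ i (P ⊗ Q ⊕ sumProducts L) ⊗ h ≈ₚ
               (Q ⊗ (∂ i P ⊗ h) ⊕ P ⊗ (∂ i Q ⊗ h)) ⊕ ∂ i (sumProducts L) ⊗ h
      expand =
        P.trans (⊗-cong (P.trans (∂-⊕ i (P ⊗ Q) (sumProducts L)) (⊕-cong (∂-⊗ i P Q) P.refl)) (P.refl {h}))
        (P.trans (P.distribʳ h (∂ i P ⊗ Q ⊕ P ⊗ ∂ i Q) (∂ i (sumProducts L)))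
        (⊕-cong (P.trans (P.distribʳ h (∂ i P ⊗ Q) (P ⊗ ∂ i Q)) (⊕-cong (xy∙z≈y∙xz (∂ i P) Q h) (P.*-assoc P (∂ i Q) h))) P.refl))

  -- Reduction of monomials modulo the ideal of the factors, with n = m + 1.

  module Reduction (m : ℕ) (ν⁻¹ : Carrier) (ν⁻¹ν≈1 : ν⁻¹ * (suc m · 1#) ≈ 1#)
                   (L : List (Polynomial (suc m) × Polynomial (suc m))) (r : Polynomial (suc m))
                   (below-r : Below (suc m) r)
                   (decomposition : powerSum (suc m) (suc m) ≈ₚ sumProducts L ⊕ r) where

    private module P = CommutativeRing (polynomialRing (suc m))

    private
      -- The decomposition is differentiated along the variable `i` and divided by n.
      x^i : ∀ i → X (x^ i m) ≈ₚ ν⁻¹ ∙ (∂ i (sumProducts L) ⊕ ∂ i r)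
      x^i i = begin
        X (x^ i m)                                ≈⟨ 1∙ _ ⟨
        1# ∙ X (x^ i m)                           ≈⟨ ∙-cong (sym ν⁻¹ν≈1) P.refl ⟩
        (ν⁻¹ * (suc m · 1#)) ∙ X (x^ i m)         ≈⟨ ∙-∙ ν⁻¹ (suc m · 1#) (X (x^ i m)) ⟨
        ν⁻¹ ∙ ((suc m · 1#) ∙ X (x^ i m))         ≈⟨ ∙-cong refl (∂-powerSum i m) ⟨
        ν⁻¹ ∙ ∂ i (powerSum (suc m) (suc m))      ≈⟨ ∙-cong refl (∂-cong i decomposition) ⟩
        ν⁻¹ ∙ ∂ i (sumProducts L ⊕ r)             ≈⟨ ∙-cong refl (∂-⊕ i (sumProducts L) r) ⟩
        ν⁻¹ ∙ (∂ i (sumProducts L) ⊕ ∂ i r)       ∎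
        where open SetoidReasoning P.setoid

      lower : ∀ {n} → Fin n → ℕ → Monomial n → Monomial n
      lower i d k = Vec.updateAt k i (_∸ d)

      x^-lower : ∀ {n} (i : Fin n) d k → d ≤ Vec.lookup k i → x^ i d +ᵐ lower i d k ≡ k
      x^-lower zero    d (a Vec.∷ k) d≤a = ≡.cong₂ Vec._∷_ (ℕ.m+[n∸m]≡n d≤a) (+ᵐ-identityˡ k)
      x^-lower (suc i) d (a Vec.∷ k) d≤k = ≡.cong (a Vec.∷_) (x^-lower i d k d≤k)

    -- Modulo the ideal of the factors, x_i^m is proportional to ∂ i r, of degree
    -- below m; hence the degree of any monomial outside the box can be lowered.
    span-X : ∀ k → Acc _<_ (Vec.sum k) → Span (BoxOrMultiple (suc m) (factors L)) (X k)
    span-X k (acc rs) with Fin.any? (λ i → suc m ℕ.≤? Vec.lookup k i)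
    ... | no none       = member (box k λ i → ℕ.≰⇒> λ m<kᵢ → none (i , m<kᵢ))
    ... | yes (i , m<kᵢ) = resp (P.sym factorise) (scale ν⁻¹
      (add (span-∂-sumProducts i L (X k′) id)
           -- The derivative of `r` has degree below `m`, whereas the power it replaces has degree
           -- exactly `m`. All monomials that arise thus have degree below that of `k`.
           (span-below (below-⊗ (below-∂ i below-r) (below-X k′)) λ l l<d →
             span-X l (rs (≡.subst (Vec.sum l <_) degree l<d)))))
      where
      k′ = lower i m k
      k≡ : x^ i m +ᵐ k′ ≡ k
      k≡ = x^-lower i m k (ℕ.<⇒≤ m<kᵢ)
      degree : m ℕ+ Vec.sum k′ ≡ Vec.sum k
      degree = ≡.trans (≡.cong (_ℕ+ Vec.sum k′) (≡.sym (sum-x^ i m))) (≡.trans (≡.sym (sum-+ᵐ (x^ i m) k′)) (≡.cong Vec.sum k≡))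
      factorise : X k ≈ₚ ν⁻¹ ∙ (∂ i (sumProducts L) ⊗ X k′ ⊕ ∂ i r ⊗ X k′)
      factorise = begin
        X k                                                       ≡⟨ ≡.cong X k≡ ⟨
        X (x^ i m +ᵐ k′)                                          ≈⟨ X-⊗ (x^ i m) k′ ⟨
        X (x^ i m) ⊗ X k′                                         ≈⟨ P.*-congʳ (x^i i) ⟩
        (ν⁻¹ ∙ (∂ i (sumProducts L) ⊕ ∂ i r)) ⊗ X k′              ≈⟨ ∙-⊗ ν⁻¹ (∂ i (sumProducts L) ⊕ ∂ i r) (X k′) ⟨
        ν⁻¹ ∙ ((∂ i (sumProducts L) ⊕ ∂ i r) ⊗ X k′)              ≈⟨ ∙-cong refl (P.distribʳ (X k′) (∂ i (sumProducts L)) (∂ i r)) ⟩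
        ν⁻¹ ∙ (∂ i (sumProducts L) ⊗ X k′ ⊕ ∂ i r ⊗ X k′)         ∎
        where open SetoidReasoning P.setoid

    span-all : ∀ p → Span (BoxOrMultiple (suc m) (factors L)) p
    span-all p = span-terms (All.universal (λ (_ , k) → span-X k (<-wellFounded _)) p)

  -- Spanning modulo high order by power products of the factors.

  module _ {n : ℕ} where

    private module P = CommutativeRing (polynomialRing n)
    open CommutativeSemigroupProperties P.*-commutativeSemigroup using (x∙yz≈y∙xz)
    open Boxes

    -- Bounding each exponent by `d` separately, instead of the total degree, keeps more products
    -- but makes the count simply `d ^ length gs`.
    boundedProducts : ℕ → List (Polynomial n) → List (Polynomial n)
    boundedProducts d []       = [ const 1# ]
    boundedProducts d (g ∷ gs) = cartesianProductWith _⊗_ (applyUpTo (g ↑_) d) (boundedProducts d gs)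

    boundedProducts-mono : ∀ {d γ} gs → γ ∈ boundedProducts d gs → γ ∈ boundedProducts (suc d) gs
    boundedProducts-mono []       γ∈ = γ∈
    boundedProducts-mono {d} (g ∷ gs) γ∈
      with _ , _ , g^e∈ , γ′∈ , ≡.refl ← ∈-cartesianProductWith⁻ _⊗_ (applyUpTo (g ↑_) d) (boundedProducts d gs) γ∈
      with _ , e<d , ≡.refl ← ∈-applyUpTo⁻ (g ↑_) g^e∈ =
      ∈-cartesianProductWith⁺ _⊗_ (∈-applyUpTo⁺ (g ↑_) (ℕ.m<n⇒m<1+n e<d)) (boundedProducts-mono gs γ′∈)

    -- One exponent grows by one, hence the bound `suc d`. Equality holds only up to `_≈ₚ_`, since
    -- `g` has to be commuted to its own power.
    boundedProducts-⊗ : ∀ {d g gs γ} → g ∈ gs → γ ∈ boundedProducts d gs →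
                        ∃[ γ′ ] γ′ ∈ boundedProducts (suc d) gs × g ⊗ γ ≈ₚ γ′
    boundedProducts-⊗ {d} {g} {g₀ ∷ gs} g∈ γ∈
      with _ , γ₁ , g^e∈ , γ₁∈ , ≡.refl ← ∈-cartesianProductWith⁻ _⊗_ (applyUpTo (g₀ ↑_) d) (boundedProducts d gs) γ∈
      with e , e<d , ≡.refl ← ∈-applyUpTo⁻ (g₀ ↑_) g^e∈
      with g∈
    ... | here ≡.refl = _ ,
      ∈-cartesianProductWith⁺ _⊗_ (∈-applyUpTo⁺ (g ↑_) (s≤s e<d)) (boundedProducts-mono gs γ₁∈) ,
      P.sym (P.*-assoc g (g ↑ e) γ₁)
    ... | there g∈gs with γ′ , γ′∈ , eq ← boundedProducts-⊗ g∈gs γ₁∈ = _ ,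
      ∈-cartesianProductWith⁺ _⊗_ (∈-applyUpTo⁺ (g₀ ↑_) (ℕ.m<n⇒m<1+n e<d)) γ′∈ ,
      P.trans (x∙yz≈y∙xz g (g₀ ↑ e) γ₁) (⊗-congˡ (g₀ ↑ e) eq)

    boxProducts : ℕ → ℕ → List (Polynomial n) → List (Polynomial n)
    boxProducts b d gs = cartesianProductWith _⊗_ (tabulate (X ∘ boxVec b)) (boundedProducts d gs)

    length-boxProducts : ∀ b d gs → length (boxProducts b d gs) ≡ b ^ n ℕ* d ^ length gs
    length-boxProducts b d gs =
      ≡.trans (length-product (tabulate (X ∘ boxVec b)) _)
        (≡.cong₂ _ℕ*_ (List.length-tabulate (X ∘ boxVec {n} b)) (length-bounded gs))
      where
      length-product : ∀ (ps qs : List (Polynomial n)) → length (cartesianProductWith _⊗_ ps qs) ≡ length ps ℕ* length qs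
      length-product []       qs = ≡.refl
      length-product (p ∷ ps) qs = ≡.trans (List.length-++ (map (p ⊗_) qs))
        (≡.cong₂ _ℕ+_ (List.length-map (p ⊗_) qs) (length-product ps qs))
      length-bounded : ∀ gs → length (boundedProducts d gs) ≡ d ^ length gs
      length-bounded []       = ≡.refl
      length-bounded (g ∷ gs) = ≡.trans (length-product (applyUpTo (g ↑_) d) _)
        (≡.cong₂ _ℕ*_ (List.length-applyUpTo (g ↑_) d) (length-bounded gs))

    -- Substitutes F[x] = ⟨box⟩ + Σ g F[x] into itself d times.
    span-boxProducts : ∀ {b gs} → All (Order 1) gs → (∀ p → Span (BoxOrMultiple b gs) p) →
                       ∀ d p → Span (λ q → q ∈ boxProducts b d gs ⊎ Order d q) p
    span-boxProducts gs-order span-all zero    p = member (inj₂ order-0)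
    span-boxProducts {b} {gs} gs-order span-all (suc d) p = span-bind substitute (span-all p)
      where
      Target : ℕ → Polynomial n → Set (c ⊔ ℓ)
      Target d q = q ∈ boxProducts b d gs ⊎ Order d q
      -- The power product with all exponents zero, available because `suc d` is positive.
      1∈ : ∀ gs → ∃[ γ ] γ ∈ boundedProducts (suc d) gs × γ ≈ₚ const 1#
      1∈ []       = _ , here ≡.refl , P.refl
      1∈ (g ∷ gs) with γ , γ∈ , γ≈1 ← 1∈ gs =
        _ , ∈-cartesianProductWith⁺ _⊗_ (∈-applyUpTo⁺ (g ↑_) {n = suc d} z<s) γ∈ ,
        P.trans (⊗-congˡ (const 1#) γ≈1) (P.*-identityʳ (const 1#))
      substitute : ∀ {q} → BoxOrMultiple b gs q → Span (Target (suc d)) q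
      substitute (box k k<b) with j , ≡.refl ← boxVec-surjective b k k<b | γ , γ∈ , γ≈1 ← 1∈ gs =
        resp (P.trans (⊗-congˡ (X k) γ≈1) (P.*-identityʳ (X k)))
             (member (inj₁ (∈-cartesianProductWith⁺ _⊗_ (∈-tabulate⁺ j) γ∈)))
      substitute (multiple {g} g∈gs h) = span-⊗ g multiply (span-boxProducts gs-order span-all d h)
        where
        multiply : ∀ {q} → Target d q → Span (Target (suc d)) (g ⊗ q)
        -- Here `g` vanishes at the origin, so multiplying by it raises the order from `d` to
        -- `suc d`.
        multiply (inj₂ dq) = member (inj₂ (order-⊗ (All.lookup gs-order g∈gs) dq))
        multiply (inj₁ q∈)
          with x , γ , x∈ , γ∈ , ≡.refl ← ∈-cartesianProductWith⁻ _⊗_ (tabulate (X ∘ boxVec b)) (boundedProducts d gs) q∈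
          with γ′ , γ′∈ , gγ≈γ′ ← boundedProducts-⊗ g∈gs γ∈ =
          resp (P.trans (⊗-congˡ x (P.sym gγ≈γ′)) (x∙yz≈y∙xz x g γ)) (member (inj₁ (∈-cartesianProductWith⁺ _⊗_ x∈ γ′∈)))

-- Dimension count: a lower bound on the number of factors.

module DecompositionBound {c ℓ₁ ℓ₂ : Level} (F : HeytingField c ℓ₁ ℓ₂) where

  open CommutativeRing (ring F) hiding (zero; ring)
  open Polynomials (ring F) hiding (sum)
  open Pairing (ring F)
  open PolynomialRing (ring F)
  open Spans (ring F)
  open Elimination F
  open Boxes
  open Mult semiring using () renaming (_×_ to _·_)
  open SemiringSum semiring using (sum; ∑-distrib-+; sum-cong-≋; sum-replicate-zero; *-distribˡ-sum)
  open SumSingle +-commutativeMonoid using (sum-single)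

  private
    -- As `r` is at most n - 1, the left side contains at most n - 1 factors `t`, times a constant
    -- of at most `n ^ n ℕ* n ^ n`. The value of `t` exceeds this constant by one.
    boxes-outnumber : ∀ m r → r < suc m → let n = suc m; t = suc (n ^ n ℕ* n ^ n) in
                      n ^ n ℕ* (n ℕ* t) ^ r < t ^ n
    boxes-outnumber m r (s≤s r≤m) = begin-strict
      n ^ n ℕ* (n ℕ* t) ^ r        ≤⟨ ℕ.*-monoʳ-≤ (n ^ n) (ℕ.^-monoʳ-≤ (n ℕ* t) r≤m) ⟩
      n ^ n ℕ* (n ℕ* t) ^ m        ≡⟨ ≡.cong (n ^ n ℕ*_) (^-distribʳ-* n t m) ⟩
      n ^ n ℕ* (n ^ m ℕ* t ^ m)    ≤⟨ ℕ.*-monoʳ-≤ (n ^ n) (ℕ.*-monoˡ-≤ (t ^ m) (ℕ.^-monoʳ-≤ n (ℕ.n≤1+n m))) ⟩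
      n ^ n ℕ* (n ^ n ℕ* t ^ m)    ≡⟨ ℕ.*-assoc (n ^ n) (n ^ n) (t ^ m) ⟨
      n ^ n ℕ* n ^ n ℕ* t ^ m      <⟨ ℕ.*-monoˡ-< (t ^ m) {{ℕ.m^n≢0 t m}} (ℕ.n<1+n (n ^ n ℕ* n ^ n)) ⟩
      t ℕ* t ^ m                   ∎
      where
      open ℕ.≤-Reasoning
      n = suc m
      t = suc (n ^ n ℕ* n ^ n)
      ^-distribʳ-* : ∀ a b e → (a ℕ* b) ^ e ≡ a ^ e ℕ* b ^ e
      ^-distribʳ-* a b zero    = ≡.refl
      ^-distribʳ-* a b (suc e) = ≡.trans (≡.cong (a ℕ* b ℕ*_) (^-distribʳ-* a b e))
        (CommutativeSemigroupProperties.interchange ℕ.*-commutativeSemigroup a b (a ^ e) (b ^ e))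

  -- A nontrivial combination of the coefficients at the box monomials that vanishes on
  -- ps would vanish on every polynomial.
  box-independent : ∀ {n} t (ps : List (Polynomial n)) {Z : Monomial n → Set} →
    ¬ (1# ≈ 0#) → length ps < t ^ n → (∀ j → Z (boxVec t j)) →
    ¬ (∀ p → Span (λ q → q ∈ ps ⊎ Vanishes Z q) p)
  box-independent {n} t ps {Z} 1≉0 ps<N inZ spans =
    -- There is one unknown for each box monomial and one equation for each member of `ps`. The
    -- resulting functional takes the value `x j` at the `j`-th box monomial, so it cannot vanish
    -- everywhere.
    nontrivial-solution 1≉0 ps<N (λ i j → coeff (List.lookup ps i) (boxVec t j)) λ (x , x≉0 , solves) →
      x≉0 λ j → trans (sym (functional-X x j)) (vanishes x solves (spans (X (boxVec t j))))
    where
    functional : (Fin (t ^ n) → Carrier) → Polynomial n → Carrier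
    functional x p = sum λ j → coeff p (boxVec t j) * x j

    functional-X : ∀ x j → functional x (X (boxVec t j)) ≈ x j
    functional-X x j =
      trans (sum-single (λ j′ → coeff (X (boxVec {n} t j)) (boxVec t j′) * x j′) j λ j′ j′≢j →
              trans (*-congʳ (trans (coeff-X (boxVec {n} t j) (boxVec t j′))
                                    (δ-≢ {m = boxVec t j′} λ eq → j′≢j (≡.sym (boxVec-injective {n} t eq)))))
                    (zeroˡ _))
            (trans (*-congʳ (trans (coeff-X (boxVec {n} t j) (boxVec t j)) (δ-refl (boxVec {n} t j)))) (*-identityˡ _))

    vanishes : ∀ x → (∀ i → functional x (List.lookup ps i) ≈ 0#) →
               ∀ {p} → Span (λ q → q ∈ ps ⊎ Vanishes Z q) p → functional x p ≈ 0#
    vanishes x solves (member (inj₁ p∈)) =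
      trans (reflexive (≡.cong (functional x) (lookup-index p∈))) (solves (index p∈))
    vanishes x solves (member (inj₂ Zp)) =
      trans (sum-cong-≋ λ j → trans (*-congʳ (coeff≈0 Zp _ (inZ j))) (zeroˡ _)) (sum-replicate-zero (t ^ n))
    vanishes x solves null = trans (sum-cong-≋ λ j → zeroˡ (x j)) (sum-replicate-zero (t ^ n))
    vanishes x solves (add {p} {q} Sp Sq) =
      trans (sum-cong-≋ λ j → trans (*-congʳ (coeff-⊕ p q _)) (distribʳ (x j) _ _))
      (trans (∑-distrib-+ (λ j → coeff p (boxVec t j) * x j) (λ j → coeff q (boxVec t j) * x j))
      (trans (+-cong (vanishes x solves Sp) (vanishes x solves Sq)) (+-identityʳ 0#)))
    vanishes x solves (scale a {p} Sp) =
      trans (sum-cong-≋ λ j → trans (*-congʳ (coeff-∙ a p _)) (*-assoc a _ (x j)))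
      (trans (sym (*-distribˡ-sum a (λ j → coeff p (boxVec t j) * x j)))
      (trans (*-congˡ (vanishes x solves Sp)) (zeroʳ a)))
    vanishes x solves (resp p≈q Sp) =
      trans (sum-cong-≋ λ j → *-congʳ (sym (≈ₚ⇒≋ p≈q (boxVec t j)))) (vanishes x solves Sp)

  -- With fewer than n factors, the box products of order bound `n ℕ* t` would span everything
  -- modulo high order, yet be outnumbered by the independent monomials of the box of side `t`.
  powerSum-factors : ∀ n {L : List (Polynomial n × Polynomial n)} {r} → ¬ (n · 1# ≈ 0#) →
    All (Order 1) (factors L) → Below n r → powerSum n n ≈ₚ sumProducts L ⊕ r → n ≤ length (factors L)
  powerSum-factors zero    _ _ _ _ = z≤n
  powerSum-factors (suc m) {L} {r} n≉0 order below decomposition =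
    -- The inequality may be proved by contradiction because it is decidable. By tightness n may
    -- then be taken apart from zero, and so invertible.
    ℕ.≮⇒≥ λ few → n≉0 (¬#0⇒≈0 λ n#0 → refute few (#0⇒inverse n#0))
    where
    n = suc m
    t = suc (n ^ n ℕ* n ^ n)
    1≉0 : ¬ (1# ≈ 0#)
    1≉0 1≈0 = n≉0 (trans (sym (*-identityʳ _)) (trans (*-congˡ 1≈0) (zeroʳ _)))
    refute : length (factors L) < n → ∃[ u ] u * (n · 1#) ≈ 1# → ⊥
    refute few (ν⁻¹ , ν⁻¹ν≈1) =
      box-independent t (boxProducts n (n ℕ* t) (factors L)) 1≉0
        (≡.subst (_< t ^ n) (≡.sym (length-boxProducts n (n ℕ* t) (factors L))) (boxes-outnumber m _ few))
        -- Monomials with exponents below `t` have degree below `n ℕ* t`, so polynomials of that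
        -- order have no coefficient at them.
        (sum-boxVec {m} t)
        (span-boxProducts order (Reduction.span-all m ν⁻¹ ν⁻¹ν≈1 L r below decomposition) (n ℕ* t))

-- Partial sums of sequences of naturals.

module PartialSums where

  sumBelow : (ℕ → ℕ) → ℕ → ℕ
  sumBelow f zero    = 0
  sumBelow f (suc k) = sumBelow f k ℕ+ f k

  sumBelow-suc : ∀ f k → sumBelow f (suc k) ≡ f 0 ℕ+ sumBelow (f ∘ suc) k
  sumBelow-suc f zero    = ℕ.+-comm 0 (f 0)
  sumBelow-suc f (suc k) = ≡.trans (≡.cong (_ℕ+ f (suc k)) (sumBelow-suc f k)) (ℕ.+-assoc (f 0) _ _)

  *≤sumBelow : ∀ {f m} k → (∀ c → c < k → m ≤ f c) → k ℕ* m ≤ sumBelow f k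
  *≤sumBelow {f} {m} zero    m≤f = z≤n
  *≤sumBelow {f} {m} (suc k) m≤f = ≡.subst (_≤ sumBelow f (suc k)) (ℕ.+-comm (k ℕ* m) m)
    (ℕ.+-mono-≤ (*≤sumBelow k λ c c<k → m≤f c (ℕ.m<n⇒m<1+n c<k)) (m≤f k (ℕ.n<1+n k)))

  sumBelow-double : ∀ (f : ℕ → ℕ) k → sumBelow (λ c → f c ℕ+ f c) k ≡ sumBelow f k ℕ+ sumBelow f k
  sumBelow-double f zero    = ≡.refl
  sumBelow-double f (suc k) = ≡.trans (≡.cong (_ℕ+ (f k ℕ+ f k)) (sumBelow-double f k))
    (CommutativeSemigroupProperties.interchange ℕ.+-commutativeSemigroup (sumBelow f k) (sumBelow f k) (f k) (f k))

-- Cutting a branching program into a sum of products.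

module BranchingPrograms {c ℓ : Level} (R : CommutativeRing c ℓ) where

  open CommutativeRing R hiding (ring; zero)
  open Polynomials R
  open Pairing R
  open PolynomialRing R
  open Spans R
  open PartialSums

  module _ {n : ℕ} where

    private module P = CommutativeRing (polynomialRing n)

    removeConst : Polynomial n → Polynomial n
    removeConst p = p ⊕ const (- coeff p 1ᵐ)

    order-removeConst : ∀ p → Order 1 (removeConst p)
    order-removeConst p = vanishing constant
      where
      sum≡0 : ∀ {n} (m : Monomial n) → Vec.sum m ≡ 0 → m ≡ 1ᵐ
      sum≡0 Vec.[]         _  = ≡.refl
      sum≡0 (zero Vec.∷ m) eq = ≡.cong (0 Vec.∷_) (sum≡0 m eq)
      constant : ∀ m → Vec.sum m < 1 → coeff (removeConst p) m ≈ 0#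
      constant m m<1 with ≡.refl ← sum≡0 m (ℕ.n<1⇒n≡0 m<1) = begin
        coeff (removeConst p) 1ᵐ                                  ≈⟨ coeff-⊕ p _ 1ᵐ ⟩
        coeff p 1ᵐ + coeff (const (- coeff p 1ᵐ)) (1ᵐ {n})
          ≈⟨ +-congˡ (coeff≈pairing (const (- coeff p 1ᵐ)) (1ᵐ {n})) ⟩
        coeff p 1ᵐ + (- coeff p 1ᵐ * δ (1ᵐ {n}) 1ᵐ + 0#)
          ≈⟨ +-congˡ (trans (+-identityʳ _) (trans (*-congˡ (δ-refl (1ᵐ {n}))) (*-identityʳ _))) ⟩
        coeff p 1ᵐ - coeff p 1ᵐ                                   ≈⟨ -‿inverseʳ _ ⟩
        0#                                                        ∎
        where open SetoidReasoning setoid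

    split-const : ∀ p → p ≈ₚ const (coeff p 1ᵐ) ⊕ removeConst p
    split-const p = P.sym (P.trans (x∙yz≈y∙xz (const (coeff p 1ᵐ)) p (const (- coeff p 1ᵐ)))
      (P.trans (P.+-cong (P.refl {p}) cancel) (P.+-identityʳ p)))
      where
      open CommutativeSemigroupProperties P.+-commutativeSemigroup using (x∙yz≈y∙xz)
      cancel : const (coeff p 1ᵐ) ⊕ const (- coeff p 1ᵐ) ≈ₚ []
      cancel = pairings λ φ → trans (+-congˡ (+-identityʳ _))
        (trans (sym (distribʳ _ _ _)) (trans (*-congʳ (-‿inverseʳ _)) (zeroˡ _)))

    -- Addition of formal sums is list concatenation, so this holds propositionally and not just up
    -- to `_≈ₚ_`.
    sum-concatMap : ∀ {a b} {A : Set a} {B : Set b} (w : B → Polynomial n) (f : A → List B) xs →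
                    sum (map w (concatMap f xs)) ≡ sum (map (λ x → sum (map w (f x))) xs)
    sum-concatMap w f []       = ≡.refl
    sum-concatMap w f (x ∷ xs) =
      ≡.trans (≡.cong sum (List.map-++ w (f x) (concatMap f xs)))
      (≡.trans (≡.sym (List.concat-++ (map w (f x)) _))
      (≡.cong (sum (map w (f x)) ⊕_) (sum-concatMap w f xs)))

  module _ {n : ℕ} {ℓ′ : Level} {Label : Polynomial n → Set ℓ′} where

    private module P = CommutativeRing (polynomialRing n)
    open SemiringSum P.semiring
      using (sum-cong-≋; ∑-distrib-+; ∑-comm; *-distribˡ-sum; *-distribʳ-sum) renaming (sum to ∑)

    label : Maybe (∃ Label) → Polynomial n
    label nothing  = []
    label (just l) = proj₁ l

    value : ∀ {a b} (G : Layered Label a b) → Fin a → Fin b → Polynomial n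
    value G u t = sum (map weight (paths G u t))

    private
      -- Gives access to the local function `via` in the definition of `paths`: unification with
      -- `≡.refl` fills it in.
      firstSteps : ∀ {a b d} (E : Edges Label a b) (G : Layered Label b d) u t →
        Σ[ via ∈ (Fin b → List (Path {Label = Label} (E ∷ G) u t)) ]
          paths {Label = Label} (E ∷ G) u t ≡ concatMap via (allFin b)
      firstSteps E G u t = _ , ≡.refl

      value-step : ∀ {a b d} {E : Edges Label a b} {G : Layered Label b d} {u t} v l eq (πs : List (Path G v t)) →
        sum (map weight (map (step {E = E} {u = u} v l eq) πs)) ≈ₚ proj₁ l ⊗ sum (map weight πs)
      value-step v l eq []       = P.sym (P.zeroʳ (proj₁ l))
      value-step v l eq (π ∷ πs) = P.trans (P.+-cong P.refl (value-step v l eq πs))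
        (P.sym (P.distribˡ (proj₁ l) (weight π) (sum (map weight πs))))

      -- The paths through v are defined by a with-abstraction of E u v in a proof of
      -- E u v ≡ E u v, of which only the right-hand side may be abstracted here.
      -- Writing E as F x, and as the convertible F tt on the left, achieves this.
      value-via : ∀ {a b d} (F : ⊤ → Edges Label a b) (x : ⊤) (G : Layered Label b d) u t v →
        sum (map weight (proj₁ (firstSteps (F x) G u t) v)) ≈ₚ label (F x u v) ⊗ value G v t
      value-via F x G u t v with F x u v | id {A = F tt u v ≡ F x u v} ≡.refl
      ... | just l  | eq = value-step v l eq (paths G v t)
      ... | nothing | eq = P.refl

    -- The path sums form the product of the label matrices of the layers, a missing edge being a
    -- zero entry.
    value-∷ : ∀ {a b d} (E : Edges Label a b) (G : Layered Label b d) u t →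
              value {b = d} (E ∷ G) u t ≈ₚ ∑ (λ v → label (E u v) ⊗ value G v t)
    value-∷ {b = b} E G u t = P.trans (≈ₚ-reflexive (sum-concatMap weight via (allFin b)))
      (P.trans (sum-allFin (λ v → sum (map weight (via v)))) (sum-cong-≋ (value-via (λ _ → E) tt G u t)))
      where
      via = proj₁ (firstSteps E G u t)

    -- Associativity of the matrix product: the row vector `p` is carried across one layer of edges.
    combination-∷ : ∀ {a b d} (E : Edges Label a b) (G : Layered Label b d) t (p : Fin a → Polynomial n) →
      ∑ (λ u → p u ⊗ value {b = d} (E ∷ G) u t) ≈ₚ ∑ (λ v → ∑ (λ u → p u ⊗ label (E u v)) ⊗ value G v t)
    combination-∷ {a} {b} E G t p = begin
      ∑ (λ u → p u ⊗ value (E ∷ G) u t)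
        ≈⟨ sum-cong-≋ (λ u → P.trans (⊗-congˡ (p u) (value-∷ E G u t)) (*-distribˡ-sum (p u) (λ v → label (E u v) ⊗ value G v t))) ⟩
      ∑ (λ u → ∑ (λ v → p u ⊗ (label (E u v) ⊗ value G v t)))
        ≈⟨ ∑-comm (λ u v → p u ⊗ (label (E u v) ⊗ value G v t)) ⟩
      ∑ (λ v → ∑ (λ u → p u ⊗ (label (E u v) ⊗ value G v t)))
        ≈⟨ sum-cong-≋ (λ v → P.trans (sum-cong-≋ λ u → P.sym (P.*-assoc (p u) (label (E u v)) (value G v t)))
                                     (P.sym (*-distribʳ-sum (value G v t) (λ u → p u ⊗ label (E u v))))) ⟩
      ∑ (λ v → ∑ (λ u → p u ⊗ label (E u v)) ⊗ value G v t) ∎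
      where open SetoidReasoning P.setoid

    -- Every (h+1)-st layer is cut, the next one c layers further on.
    cutWidth : ∀ (h c : ℕ) {a b} → Layered Label a b → ℕ
    cutWidth h c       []                  = 0
    cutWidth h zero    (_∷_ {a = a} E G)   = a ℕ+ cutWidth h h G
    cutWidth h (suc c) (E ∷ G)             = cutWidth h c G

    -- Both factors of a pair must vanish at the origin, which is what gives their power products
    -- high order later. The count `w` is exact, so that the widths of successive cuts add up.
    record Decomposition (D w : ℕ) (f : Polynomial n) : Set (c ⊔ ℓ) where
      constructor decomposition
      field
        pairs      : List (Polynomial n × Polynomial n)
        remainder  : Polynomial n
        number     : length pairs ≡ w
        orders     : All (λ (p , q) → Order 1 p × Order 1 q) pairs
        degree     : Below (suc D) remainder
        decomposes : f ≈ₚ sumProducts pairs ⊕ remainder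

    decomposition-resp : ∀ {D w f g} → f ≈ₚ g → Decomposition D w g → Decomposition D w f
    decomposition-resp f≈g (decomposition L r len ord deg eq) = decomposition L r len ord deg (P.trans f≈g eq)

    module Cutting (Δ h : ℕ) (label-degree : ∀ {p} → Label p → Below (suc Δ) p) where

      private
        below-label : ∀ l → Below (suc Δ) (label l)
        below-label nothing  = vanishing λ m z → refl
        below-label (just l) = label-degree (proj₂ l)

        below-combination : ∀ {a b} (E : Edges Label a b) e (p : Fin a → Polynomial n) →
          (∀ u → Below (suc (e ℕ* Δ)) (p u)) → ∀ v → Below (suc (suc e ℕ* Δ)) (∑ (λ u → p u ⊗ label (E u v)))
        below-combination E e p deg v = vanishes-∑ (λ u → p u ⊗ label (E u v)) λ u →
          ≡.subst (λ d → Below (suc d) (p u ⊗ label (E u v))) (ℕ.+-comm (e ℕ* Δ) Δ) (below-⊗ (deg u) (below-label (E u v)))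

        below-value-[] : ∀ {a} (u t : Fin a) → Below 1 (value [] u t)
        below-value-[] u t with u Fin.≟ t
        ... | yes ≡.refl = ≡.subst (Below 1) (≡.sym (List.++-identityʳ (const 1#))) (below-const 1#)
        ... | no _       = vanishing λ m z → refl

        -- Asymmetric on purpose: beside the constant `a` the whole of `q` is kept, since it is a
        -- path sum that can be decomposed further, while the last term has no more than the degree
        -- bound of `p`.
        split-product : ∀ p q → let a = const (coeff p 1ᵐ); b = const (coeff q 1ᵐ) in
          p ⊗ q ≈ₚ removeConst p ⊗ removeConst q ⊕ (a ⊗ q ⊕ removeConst p ⊗ b)
        split-product p q = begin
          p ⊗ q                                 ≈⟨ ⊗-cong (split-const p) P.refl ⟩
          (a ⊕ p′) ⊗ q                          ≈⟨ P.distribʳ q a p′ ⟩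
          a ⊗ q ⊕ p′ ⊗ q                        ≈⟨ ⊕-cong P.refl (P.trans (⊗-congˡ p′ (split-const q)) (P.distribˡ p′ b q′)) ⟩
          a ⊗ q ⊕ (p′ ⊗ b ⊕ p′ ⊗ q′)            ≈⟨ P.+-assoc (a ⊗ q) (p′ ⊗ b) (p′ ⊗ q′) ⟨
          (a ⊗ q ⊕ p′ ⊗ b) ⊕ p′ ⊗ q′            ≈⟨ ⊕-comm (a ⊗ q ⊕ p′ ⊗ b) (p′ ⊗ q′) ⟩
          p′ ⊗ q′ ⊕ (a ⊗ q ⊕ p′ ⊗ b)            ∎
          where
          open SetoidReasoning P.setoid
          a = const (coeff p 1ᵐ)
          b = const (coeff q 1ᵐ)
          p′ = removeConst p
          q′ = removeConst q

        -- The terms of `split-product` part ways: products of constant-free factors become new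
        -- pairs, one for each vertex; terms with a constant second factor join the remainder; terms
        -- with a constant first factor are decomposed by hypothesis.
        cut : ∀ {a D w} (p q : Fin a → Polynomial n) → (∀ u → Below (suc D) (p u)) →
              Decomposition D w (∑ (λ u → const (coeff (p u) 1ᵐ) ⊗ q u)) →
              Decomposition D (a ℕ+ w) (∑ (λ u → p u ⊗ q u))
        cut {a} {D} p q deg (decomposition L r len ord deg-r eq) = decomposition
          (tabulate pair ++ L) (r ⊕ s)
          (≡.trans (List.length-++ (tabulate pair)) (≡.cong₂ _ℕ+_ (List.length-tabulate pair) len))
          (All.++⁺ (All.tabulate⁺ λ u → order-removeConst (p u) , order-removeConst (q u)) ord)
          (vanishes-⊕ deg-r (vanishes-∑ _ λ u → below-s u))
          (begin
            ∑ (λ u → p u ⊗ q u)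
              ≈⟨ sum-cong-≋ (λ u → split-product (p u) (q u)) ⟩
            ∑ (λ u → p′ u ⊗ q′ u ⊕ (const (coeff (p u) 1ᵐ) ⊗ q u ⊕ p′ u ⊗ const (coeff (q u) 1ᵐ)))
              ≈⟨ ∑-distrib-+ (λ u → p′ u ⊗ q′ u) _ ⟩
            ∑ (λ u → p′ u ⊗ q′ u) ⊕ ∑ (λ u → const (coeff (p u) 1ᵐ) ⊗ q u ⊕ p′ u ⊗ const (coeff (q u) 1ᵐ))
              ≈⟨ ⊕-cong P.refl (P.trans (∑-distrib-+ (λ u → const (coeff (p u) 1ᵐ) ⊗ q u) _) (⊕-cong eq P.refl)) ⟩
            ∑ (λ u → p′ u ⊗ q′ u) ⊕ ((sumProducts L ⊕ r) ⊕ s)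
              ≈⟨ ⊕-cong (P.refl {∑ (λ u → p′ u ⊗ q′ u)}) (P.+-assoc (sumProducts L) r s) ⟩
            ∑ (λ u → p′ u ⊗ q′ u) ⊕ (sumProducts L ⊕ (r ⊕ s))
              ≈⟨ P.+-assoc (∑ (λ u → p′ u ⊗ q′ u)) (sumProducts L) (r ⊕ s) ⟨
            (∑ (λ u → p′ u ⊗ q′ u) ⊕ sumProducts L) ⊕ (r ⊕ s)
              ≡⟨ ≡.cong (_⊕ (r ⊕ s)) sumProducts-pairs ⟨
            sumProducts (tabulate pair ++ L) ⊕ (r ⊕ s) ∎)
          where
          open SetoidReasoning P.setoid
          p′ = removeConst ∘ p
          q′ = removeConst ∘ q
          pair : Fin a → Polynomial n × Polynomial n
          pair u = p′ u , q′ u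
          s = ∑ (λ u → p′ u ⊗ const (coeff (q u) 1ᵐ))
          below-s : ∀ u → Below (suc D) (p′ u ⊗ const (coeff (q u) 1ᵐ))
          below-s u = below-mono (ℕ.≤-reflexive (ℕ.+-identityʳ (suc D)))
            (below-⊗ (vanishes-⊕ (deg u) (below-mono (s≤s z≤n) (below-const _))) (below-const (coeff (q u) 1ᵐ)))
          sumProducts-pairs : sumProducts (tabulate pair ++ L) ≡ ∑ (λ u → p′ u ⊗ q′ u) ⊕ sumProducts L
          sumProducts-pairs =
            ≡.trans (≡.cong sum (List.map-++ _ (tabulate pair) L))
            (≡.trans (≡.sym (List.concat-++ (map _ (tabulate pair)) _))
            (≡.cong (_⊕ sumProducts L) (≡.trans (≡.cong sum (List.map-tabulate pair _)) (sum-tabulate (λ u → p′ u ⊗ q′ u)))))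

      -- The p u sum the paths from the last cut, e layers back, to the vertices u of
      -- the current layer.
      decompose : ∀ {a b} (G : Layered Label a b) t e c → e ℕ+ c ≡ suc h → (p : Fin a → Polynomial n) →
        (∀ u → Below (suc (e ℕ* Δ)) (p u)) →
        Decomposition (suc h ℕ* Δ) (cutWidth h c G) (∑ (λ u → p u ⊗ value G u t))
      -- The last layer is never cut, even for `c = 0`: the path sums there are constants, so
      -- everything has degree at most `e ℕ* Δ` and goes into the remainder.
      decompose [] t e c e+c≡h p deg = decomposition [] (∑ (λ u → p u ⊗ value [] u t)) ≡.refl []
        (vanishes-∑ _ λ u → below-mono
          (s≤s (≡.subst (_≤ suc h ℕ* Δ) (≡.sym (ℕ.+-identityʳ (e ℕ* Δ)))
                        (ℕ.*-monoˡ-≤ Δ (ℕ.m+n≤o⇒m≤o e (ℕ.≤-reflexive e+c≡h)))))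
          (below-⊗ (deg u) (below-value-[] u t)))
        P.refl
      decompose (E ∷ G) t e (suc c) e+c≡h p deg = decomposition-resp (combination-∷ E G t p)
        (decompose G t (suc e) c (≡.trans (≡.sym (ℕ.+-suc e c)) e+c≡h) _ (below-combination E e p deg))
      decompose (E ∷ G) t e zero e≡h p deg = cut p (λ u → value (E ∷ G) u t)
        (λ u → below-mono (s≤s (ℕ.*-monoˡ-≤ Δ (ℕ.m+n≤o⇒m≤o e (ℕ.≤-reflexive e≡h)))) (deg u))
        (decomposition-resp (combination-∷ E G t constants)
          -- The constant parts restart the count at this layer. Crossing its outgoing edges leaves
          -- `e = 1`, with `h` layers to go before the next cut.
          (decompose G t 1 h ≡.refl _ (below-combination E 0 constants λ u → below-const (coeff (p u) 1ᵐ))))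
        where
        constants : Fin _ → Polynomial n
        constants u = const (coeff (p u) 1ᵐ)

    -- Different offsets cut disjoint sets of layers. Offset zero cuts the first layer and continues
    -- with offset `h`, while every other offset drops by one, so the offsets on the rest of the
    -- program are again all of 0 to `h`.
    sum-cutWidth : ∀ h {a b} (G : Layered Label a b) → sumBelow (λ c → cutWidth h c G) (suc h) ≤ vertices G
    sum-cutWidth h {a} []            = ≡.subst (_≤ a) (≡.sym (zeros (suc h))) z≤n
      where
      zeros : ∀ k → sumBelow (λ _ → 0) k ≡ 0
      zeros zero    = ≡.refl
      zeros (suc k) = ≡.trans (ℕ.+-identityʳ _) (zeros k)
    sum-cutWidth h (_∷_ {a = a} E G) = begin
      sumBelow (λ c → cutWidth h c (E ∷ G)) (suc h)                       ≡⟨ sumBelow-suc (λ c → cutWidth h c (E ∷ G)) h ⟩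
      a ℕ+ cutWidth h h G ℕ+ sumBelow (λ c → cutWidth h c G) h            ≡⟨ ℕ.+-assoc a _ _ ⟩
      a ℕ+ (cutWidth h h G ℕ+ sumBelow (λ c → cutWidth h c G) h)          ≡⟨ ≡.cong (a ℕ+_) (ℕ.+-comm (cutWidth h h G) _) ⟩
      a ℕ+ sumBelow (λ c → cutWidth h c G) (suc h)                        ≤⟨ ℕ.+-monoʳ-≤ a (sum-cutWidth h G) ⟩
      a ℕ+ vertices G                                                     ∎
      where open ℕ.≤-Reasoning

-- From cut widths to the size of the program.

module SizeBound {c ℓ₁ ℓ₂ : Level} (F : HeytingField c ℓ₁ ℓ₂) where

  open CommutativeRing (ring F) hiding (ring; zero)
  open Polynomials (ring F)
  open Pairing (ring F)
  open PolynomialRing (ring F)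
  open Spans (ring F)
  open BranchingPrograms (ring F)
  open PartialSums
  open DecompositionBound F
  open Mult semiring using () renaming (_×_ to _·_)

  affine⇒below : ∀ {n} {p : Polynomial n} → IsAffine p → Below 2 p
  affine⇒below {n} (a₀ , a , p≋) = vanishes-resp (≈ₚ-sym (≋⇒≈ₚ p≋)) (vanishes-⊕ (below-mono (s≤s z≤n) (below-const a₀))
    (vanishes-resp (≈ₚ-sym (sum-allFin (λ i → const (a i) ⊗ var i)))
      (vanishes-∑ _ λ i → below-⊗ (below-const (a i)) (≡.subst (λ d → Below (suc d) (var i)) (sum-x^ i 1) (below-X (x^ i 1))))))

  module _ {n : ℕ} {ℓ′ : Level} {Label : Polynomial n → Set ℓ′} where

    private module P = CommutativeRing (polynomialRing n)

    -- Each cut vertex yields a pair of factors, so the width counts twice. The remainder has degree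
    -- at most `suc h ℕ* Δ`, hence below n.
    cutWidth-bound : ∀ Δ h → (∀ {p} → Label p → Below (suc Δ) p) → suc h ℕ* Δ < n → ¬ (n · 1# ≈ 0#) →
      (A : ABP Label) → Computes A (powerSum n n) → ∀ c → c < suc h → n ≤ cutWidth h c A ℕ+ cutWidth h c A
    cutWidth-bound Δ h label-degree hΔ<n n≉0 A computes c c<h =
      ≡.subst (n ≤_) (≡.trans (length-factors pairs) (≡.cong₂ _ℕ+_ number number))
        (powerSum-factors n n≉0 (order-factors orders) (below-mono hΔ<n degree)
          (P.trans (≈ₚ-sym (≋⇒≈ₚ computes)) (P.trans (≈ₚ-sym start) decomposes)))
      where
      open SemiringSum P.semiring using () renaming (sum to ∑)
      start : ∑ {1} (λ u → const 1# ⊗ value A u zero) ≈ₚ value A zero zero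
      start = P.trans (P.+-identityʳ (const 1# ⊗ value A zero zero)) (P.*-identityˡ (value A zero zero))
      -- The start vertex is treated as lying `suc h ∸ c` layers after an imaginary cut, to meet the
      -- invariant of `decompose`. The prefix there is 1, which satisfies any of the degree bounds.
      open Decomposition (Cutting.decompose Δ h label-degree A zero (suc h ∸ c) c (ℕ.m∸n+n≡m (ℕ.<⇒≤ c<h))
        (λ _ → const 1#) (λ _ → below-mono (s≤s z≤n) (below-const 1#)))
      length-factors : (L : List (Polynomial n × Polynomial n)) → length (factors L) ≡ length L ℕ+ length L
      length-factors []      = ≡.refl
      length-factors (_ ∷ L) = ≡.cong suc (≡.trans (≡.cong suc (length-factors L)) (≡.sym (ℕ.+-suc (length L) (length L))))
      order-factors : {L : List (Polynomial n × Polynomial n)} →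
                      All (λ (p , q) → Order 1 p × Order 1 q) L → All (Order 1) (factors L)
      order-factors []              = []
      order-factors ((p , q) ∷ pqs) = p ∷ q ∷ order-factors pqs

    -- Multiplies n ≤ 2HΔ by n and inserts Hn ≤ 2 `size A`, whence the constant 4.
    size-bound : ∀ Δ → 0 < Δ → Δ < n → (∀ {p} → Label p → Below (suc Δ) p) → ¬ (n · 1# ≈ 0#) →
      (A : ABP Label) → Computes A (powerSum n n) → n ^ 2 ≤ 4 ℕ* (Δ ℕ* size A)
    size-bound Δ@(suc _) 0<Δ (s≤s {n = m} Δ≤m) label-degree n≉0 A computes = begin
      n ^ 2                                         ≡⟨ ≡.cong (n ℕ*_) (ℕ.*-identityʳ n) ⟩
      n ℕ* n                                        ≤⟨ ℕ.*-monoˡ-≤ n n≤2HΔ ⟩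
      (H ℕ* Δ ℕ+ H ℕ* Δ) ℕ* n
        ≡⟨ solve 3 (λ H Δ n → (H :* Δ :+ H :* Δ) :* n := con 2 :* Δ :* (H :* n)) ≡.refl H Δ n ⟩
      2 ℕ* Δ ℕ* (H ℕ* n)                            ≤⟨ ℕ.*-monoʳ-≤ (2 ℕ* Δ) Hn≤2size ⟩
      2 ℕ* Δ ℕ* (size A ℕ+ size A)
        ≡⟨ solve 2 (λ Δ s → con 2 :* Δ :* (s :+ s) := con 4 :* (Δ :* s)) ≡.refl Δ (size A) ⟩
      4 ℕ* (Δ ℕ* size A)                            ∎
      where
      open ℕ.≤-Reasoning
      open +-*-Solver
      -- As m = n - 1, this is the largest H with HΔ < n. It is positive by `Δ≤m`, and thus of the
      -- form `suc h`.
      H = m / Δ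
      h = pred H
      H≡1+h : suc h ≡ H
      H≡1+h = ℕ.suc-pred H {{>-nonZero (m≥n⇒m/n>0 Δ≤m)}}
      m≡ : m ≡ m % Δ ℕ+ H ℕ* Δ
      m≡ = m≡m%n+[m/n]*n m Δ
      HΔ<n : suc h ℕ* Δ < n
      HΔ<n = s≤s (≡.subst (λ k → k ℕ* Δ ≤ m) (≡.sym H≡1+h) (≡.subst (H ℕ* Δ ≤_) (≡.sym m≡) (ℕ.m≤n+m (H ℕ* Δ) (m % Δ))))
      n≤2HΔ : n ≤ H ℕ* Δ ℕ+ H ℕ* Δ
      n≤2HΔ = begin
        suc m                      ≡⟨ ≡.cong suc m≡ ⟩
        -- The remainder plus one is at most Δ, which is at most HΔ since H is positive.
        suc (m % Δ) ℕ+ H ℕ* Δ      ≤⟨ ℕ.+-monoˡ-≤ (H ℕ* Δ) (ℕ.≤-trans (m%n<n m Δ) (ℕ.m≤n*m Δ H {{>-nonZero (m≥n⇒m/n>0 Δ≤m)}})) ⟩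
        H ℕ* Δ ℕ+ H ℕ* Δ           ∎
      width : ℕ → ℕ
      width c = cutWidth h c A
      Hn≤2size : H ℕ* n ≤ size A ℕ+ size A
      Hn≤2size = begin
        H ℕ* n                                              ≡⟨ ≡.cong (_ℕ* n) H≡1+h ⟨
        suc h ℕ* n
          ≤⟨ *≤sumBelow (suc h) (cutWidth-bound Δ h label-degree HΔ<n n≉0 A computes) ⟩
        sumBelow (λ c → width c ℕ+ width c) (suc h)         ≡⟨ sumBelow-double width (suc h) ⟩
        sumBelow width (suc h) ℕ+ sumBelow width (suc h)    ≤⟨ ℕ.+-mono-≤ (sum-cutWidth h A) (sum-cutWidth h A) ⟩
        size A ℕ+ size A                                    ∎

-- Affine labels and labels of degree at most Δ.

open import Data.Nat.Base using (_*_)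

theorem1p2 : ∀ {c ℓ₁ ℓ₂ : Level} →
    ∃[ K ] (0 < K ×
    (∀ (F : HeytingField c ℓ₁ ℓ₂) (p n : ℕ) →
    HasCharacteristic (ring F) p → ¬ (p ∣ n) →
    let open Polynomials (ring F) in
    (∀ (A : ABP {n} IsAffine) → Computes A (powerSum n n) →
    n ^ 2 ≤ K * size A)
    ×
    (∀ (Δ : ℕ) → 0 < Δ → Δ < n →
    ∀ (A : ABP {n} (DegreeAtMost Δ)) → Computes A (powerSum n n) →
    n ^ 2 ≤ K * (Δ * size A))))
theorem1p2 {c} {ℓ₁} {ℓ₂} = 4 , z<s , λ F p n characteristic p∤n →
  let open CommutativeRing (ring F) using (_≈_; 0#; 1#; semiring)
      open Mult semiring using () renaming (_×_ to _·_)
      n≉0 : ¬ (n · 1# ≈ 0#)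
      n≉0 = p∤n ∘ Equivalence.to (characteristic n)
  in affine F n n≉0 , λ Δ 0<Δ Δ<n A →
     SizeBound.size-bound F Δ 0<Δ Δ<n (λ deg → PolynomialRing.vanishing deg) n≉0 A
  where
  module _ (F : HeytingField c ℓ₁ ℓ₂) where
    open CommutativeRing (ring F) using (_≈_; 0#; 1#; semiring)
    open Mult semiring using () renaming (_×_ to _·_)
    open Polynomials (ring F)

    0<vertices : ∀ {n} {b} (A : Layered {n} IsAffine 1 b) → 0 < vertices A
    0<vertices []      = z<s
    0<vertices (E ∷ A) = z<s

    affine : ∀ n → ¬ (n · 1# ≈ 0#) → (A : ABP {n} IsAffine) → Computes A (powerSum n n) → n ^ 2 ≤ 4 * size A
    affine zero          n≉0 A _ = z≤n
    -- For affine labels Δ = 1, and `size-bound` asks for Δ < n. At n = 1 it is enough that a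
    -- program has a vertex.
    affine (suc zero)    n≉0 A _ = ℕ.≤-trans (0<vertices A) (ℕ.m≤n*m (size A) 4)
    affine (suc (suc m)) n≉0 A computes =
      ≡.subst (λ s → suc (suc m) ^ 2 ≤ 4 * s) (ℕ.*-identityˡ (size A))
        (SizeBound.size-bound F 1 z<s (s≤s z<s) (SizeBound.affine⇒below F) n≉0 A computes)
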